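{- Let $u\in\mathbb{Q}$ and let $$g_u(t)=t^{ -1}\prod_{i=0}^{\infty}\bigl(1+u\,t^{ -2^i}\bigr)\in\mathbb{Q}((t^{ -1})),$$ the Laurent series solution of the Mahler equation $g_u(t)=(t+u)\,g_u(t^2)$. If $u\notin\{ -1,0,1\}$, then $g_u\in\mathbf{ELC}_{1/2}$. If $u=-1$, then $g_u\in\mathbf{Bad}_{1/2}\setminus\mathbf{ELC}$.
   Context: Let $\mathbb{F}$ be a field (here $\mathbb{F}=\mathbb{Q}$). Write $\alpha\in\mathbb{F}((t^{ -1}))$ as $\alpha=\sum_{k=-h}^{\infty}a_kt^{ -k}$ with $a_{ -h}\neq0$, and put $|\alpha|=2^{h}$ (and $|0|=0$). Define $\|\alpha\|=\min_{p\in\mathbb{F}[t]}|\alpha-p|=\bigl|\sum_{k\ge1}a_kt^{ -k}\bigr|$. For $\delta>0$, $\mathbf{ELC}_\delta$ is the set of $\alpha\in\mathbb{F}((t^{ -1}))$ such that $\inf_{q\in\mathbb{F}[t]\setminus\{0\},\,k\ge0}|q|\cdot\|q\,t^k\alpha\|\ge\delta$. $\mathbf{ELC}$ is the set of $\alpha$ for which this infimum is $>0$; this is the set of counterexamples to the $t$-adic Littlewood conjecture. $\mathbf{Bad}_\delta$ is the set of $\alpha$ with $\liminf_{q\in\mathbb{F}[t],\,|q|\to\infty}|q|\cdot\|q\alpha\|\ge\delta$. -}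

module Defs where

open import Data.Nat as ℕ using (ℕ; zero; suc)
open import Data.Nat using () renaming (_^_ to _^ℕ_)
open import Data.Integer as ℤ using (ℤ; +_; -[1+_])
open import Data.Rational as ℚ using (ℚ; 0ℚ; 1ℚ; ½; _+_; _*_; _-_)
open import Data.Fin using (Fin; toℕ; fromℕ)
open import Data.Product using (Σ; _×_; ∃)
open import Relation.Binary.PropositionalEquality using (_≡_; _≢_)
open import Relation.Nullary using (¬_; Dec; yes; no)

2ℚ : ℚ
2ℚ = 1ℚ + 1ℚ

_^_ : ℚ → ℕ → ℚ
x ^ zero  = 1ℚ
x ^ suc n = x * (x ^ n)

pow2 : ℤ → ℚ
pow2 (+ n)      = 2ℚ ^ n
pow2 -[1+ n ]   = ½ ^ suc n

-- Laurent series in t⁻¹ over ℚ.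
-- A Laurent series α = Σ_{k ≥ -h} a_k t^{-k} is given by its coefficient
-- function  coeff α k = a_k  (coefficient of t^{-k}, k ∈ ℤ), together with
-- a bound H such that a_k = 0 for all k < -H.

record Laurent : Set where
  field
    coeff : ℤ → ℚ
    bound : ℤ
    finite-left : ∀ k → k ℤ.< ℤ.- bound → coeff k ≡ 0ℚ
open Laurent public

-- Nonzero polynomials in ℚ[t].
-- A nonzero polynomial of degree d is q = Σ_{j=0}^{d} c_j t^j with c_d ≠ 0;
-- then |q| = 2^d.

record NZPoly : Set where
  field
    deg  : ℕ
    cf   : Fin (suc deg) → ℚ
    lead : cf (fromℕ deg) ≢ 0ℚ
open NZPoly public

sumFin : ∀ {n} → (Fin n → ℚ) → ℚ
sumFin {zero}  f = 0ℚ
sumFin {suc n} f = f Data.Fin.zero + sumFin (λ i → f (Data.Fin.suc i))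

-- coefficient of t^{-m} in  q · t^k · α :
--   Σ_{j=0}^{d} c_j · a_{m + j + k}
mulCoeff : NZPoly → ℕ → Laurent → ℤ → ℚ
mulCoeff q k α m =
  sumFin (λ (j : Fin (suc (deg q))) →
    cf q j * coeff α (m ℤ.+ + toℕ j ℤ.+ + k))

-- The quantity |q| · ‖β‖, where β has coefficient function b
-- (b m = coefficient of t^{-m}) and ‖β‖ = |Σ_{m≥1} b_m t^{-m}|.
--   * ‖β‖ = 0        iff  b m = 0 for all m ≥ 1;
--   * ‖β‖ = 2^{-m}   iff  m ≥ 1 is least with b m ≠ 0.
-- "|q|·‖β‖ ≥ δ" (with |q| = 2^d) is then defined by cases on the value of ‖β‖.

FracZero : (ℤ → ℚ) → Set
FracZero b = ∀ (m : ℕ) → 1 ℕ.≤ m → b (+ m) ≡ 0ℚ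

FracOrd : (ℤ → ℚ) → ℕ → Set
FracOrd b m = (1 ℕ.≤ m) × (b (+ m) ≢ 0ℚ)
            × (∀ (m' : ℕ) → 1 ℕ.≤ m' → m' ℕ.< m → b (+ m') ≡ 0ℚ)

NormProdGE : ℕ → (ℤ → ℚ) → ℚ → Set
NormProdGE d b δ =
  (FracZero b → 0ℚ ℚ.≥ δ) ×
  (∀ (m : ℕ) → FracOrd b m → pow2 (+ d ℤ.- + m) ℚ.≥ δ)

ELC[_] : ℚ → Laurent → Set
ELC[ δ ] α = ∀ (q : NZPoly) (k : ℕ) → NormProdGE (deg q) (mulCoeff q k α) δ

ELC : Laurent → Set
ELC α = Σ ℚ λ δ → (δ ℚ.> 0ℚ) × ELC[ δ ] α

-- Bad_δ : liminf_{|q|→∞} |q| · ‖q α‖ ≥ δ, i.e.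
--   ∀ ε > 0, ∃ N, ∀ q ≠ 0 with deg q ≥ N,  |q| · ‖q α‖ ≥ δ - ε
Bad[_] : ℚ → Laurent → Set
Bad[ δ ] α = ∀ (ε : ℚ) → ε ℚ.> 0ℚ → Σ ℕ λ N →
  ∀ (q : NZPoly) → N ℕ.≤ deg q → NormProdGE (deg q) (mulCoeff q 0 α) (δ - ε)

-- g_u(t) = t^{-1} ∏_{i ≥ 0} (1 + u t^{-2^i}).
-- Write x = t^{-1}.  prodCoeff u N n = coefficient of x^n in the finite
-- product P_N(x) = ∏_{i<N} (1 + u x^{2^i}), computed via
--   P_0 = 1,  P_{N+1}(x) = P_N(x) · (1 + u x^{2^N}).

prodCoeff : ℚ → ℕ → ℕ → ℚ
prodCoeff u zero    zero    = 1ℚ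
prodCoeff u zero    (suc n) = 0ℚ
prodCoeff u (suc N) n with (2 ^ℕ N) ℕ.≤? n
... | yes _ = prodCoeff u N n + u * prodCoeff u N (n ℕ.∸ (2 ^ℕ N))
... | no  _ = prodCoeff u N n

-- The coefficient of x^n in the infinite product: the factors with
-- 2^i > n do not affect it, so it equals the coefficient in P_{n+1}.
infProdCoeff : ℚ → ℕ → ℚ
infProdCoeff u n = prodCoeff u (suc n) n

gCoeff : ℚ → ℤ → ℚ
gCoeff u (+ zero)    = 0ℚ
gCoeff u (+ (suc n)) = infProdCoeff u n
gCoeff u -[1+ n ]    = 0ℚ

g-finite-left : ∀ u k → k ℤ.< ℤ.- (+ 0) → gCoeff u k ≡ 0ℚ
g-finite-left u (+ zero)    (ℤ.+<+ ())
g-finite-left u (+ suc n)   (ℤ.+<+ ())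
g-finite-left u -[1+ n ]    _ = Relation.Binary.PropositionalEquality.refl

g : ℚ → Laurent
g u = record { coeff = gCoeff u ; bound = + 0 ; finite-left = g-finite-left u }

{-# OPTIONS --safe #-}

-- Write wₙ = u^(s(n)), s the binary digit sum, for the coefficients of g = g_u. The claim for
-- fixed k says that the Hankel matrices (w_{k+i+j}) are nonsingular. Since w₂ₙ = wₙ and
-- w₂ₙ₊₁ = u wₙ, writing (t + u) q(t) = A(t²) + t B(t²) turns vanishing of the coefficients of
-- t^k q g into vanishing for A and B, which have half the length, and A(u²) = u B(u²). By
-- induction one of A, B is zero, and then the other one is a multiple, vanishing at u², of the
-- denominator P of a convergent of some t^k′ g. So it suffices that P(u²) ≠ 0.
--
-- If the numerator a of u is not ±1, let R ⊂ ℚ be the fractions with denominator ≡ 1 mod a.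
-- Running the splitting backwards builds the P with P(0) = 1 and P(ux) ∈ R[x], whence
-- P(u²) ∈ 1 + uR is a unit. If a = ±1, reversing a window [0, 2^M) replaces u by 1/u.
--
-- For u = -1 only k = 0 is needed. There the convergents satisfy Q₂ₑ = Qₑ(t²) and
-- Q₂ₑ₊₁ = (t + 1) r(t²) with (s - 1) r = Qₑ₊₁ - c Qₑ, and 2-adically Qₙ(1) ∈ 2(1 + 2R) and
-- Q′ₙ(1) ∈ n + 2R for n ≥ 1. For k = 2p, p = 2^i, the coefficients are p-antiperiodic on a
-- window of length 4p, so q = 1 + t^p gives |q| ‖q t^k g‖ = 2^(-2p-1).
module Submission where

open import Defs
open import Data.Nat as ℕ using (ℕ; zero; suc; s≤s; z≤n; _∸_; ⌊_/2⌋; ⌈_/2⌉)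
import Data.Nat.Properties as ℕ
import Data.Nat.Coprimality as C
open import Data.Nat.GCD using (module Bézout)
open import Data.Nat.Induction using (<-rec)
open import Data.Nat.Tactic.RingSolver as ℕ-Ring using ()
open import Data.Integer as ℤ using (ℤ; +[1+_]; -[1+_]; 0ℤ; 1ℤ)
import Data.Integer.Properties as ℤ
open import Data.Integer.Tactic.RingSolver as ℤ-Ring using ()
open import Data.Fin using (Fin; toℕ; fromℕ; zero; suc)
open import Data.Fin.Properties using (toℕ-fromℕ)
open import Data.Rational using (ℚ; mkℚ; 0ℚ; 1ℚ; ½; -_; _+_; _*_; _-_; _/_; 1/_; ↥_; NonZero; ≢-nonZero; nonNegative; _≤_; _<_; *≤*; *<*; _≤?_; _<?_)
open import Data.Rational.Properties using (*-assoc; *-comm; *-identityʳ; *-identityˡ; *-inverseʳ; *-inverseˡ; *-monoʳ-≤-nonNeg; *-monoˡ-<-pos; *-monoˡ-≤-nonNeg; *-zeroʳ; *-zeroˡ; +-identityʳ; +-identityˡ; +-mono-≤; +-mono-≤-<; +-monoʳ-≤; <-irrefl; <-≤-trans; <⇒≤; neg-antimono-≤; ↥p/↧p≡p; ≤-<-trans; ≤-refl; ≤-reflexive; ≤-trans; ≰⇒>)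
open import Data.Rational.Solver using (module +-*-Solver)
open import Data.Vec using (Vec; []; _∷_; _∷ʳ_; zipWith; head; replicate; map; initLast; reverse; tabulate)
open import Data.Vec.Properties using (reverse-∷)
open import Data.Vec.Relation.Unary.All using (All; []; _∷_)
open import Data.Vec.Relation.Unary.All.Properties using (tabulate⁻)
open import Data.Product using (Σ; _×_; _,_; ∃; ∃₂; proj₁; proj₂)
open import Data.Sum using (_⊎_; inj₁; inj₂)
open import Data.Unit using (⊤; tt)
open import Data.Empty using (⊥)
open import Relation.Nullary using (¬_; yes; no; contradiction)
open import Relation.Nullary.Decidable using (from-yes)
open import Relation.Binary.PropositionalEquality using (_≡_; _≢_; refl; sym; trans; cong; cong₂; subst; module ≡-Reasoning)
open +-*-Solver
open ≡-Reasoning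

private variable
  n : ℕ

-- Cancellation in ℚ, and doubling and halving in ℕ.

*≡0⇒≡0 : ∀ x y → x * y ≡ 0ℚ → y ≢ 0ℚ → x ≡ 0ℚ
*≡0⇒≡0 x y xy≡0 y≢0 = begin
  x               ≡⟨ sym (*-identityʳ x) ⟩
  x * 1ℚ          ≡⟨ cong (x *_) (sym (*-inverseʳ y)) ⟩
  x * (y * 1/ y)  ≡⟨ sym (*-assoc x y (1/ y)) ⟩
  x * y * 1/ y    ≡⟨ cong (_* 1/ y) xy≡0 ⟩
  0ℚ * 1/ y       ≡⟨ *-zeroˡ (1/ y) ⟩
  0ℚ              ∎
  where instance _ = ≢-nonZero y≢0

invertible⇒≢0 : ∀ x y → y * x ≡ 1ℚ → x ≢ 0ℚ
invertible⇒≢0 x y yx≡1 refl with trans (sym (*-zeroʳ y)) yx≡1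
... | ()

dbl : ℕ → ℕ
dbl zero    = zero
dbl (suc n) = suc (suc (dbl n))

dbl-≥ : ∀ n → n ℕ.≤ dbl n
dbl-≥ zero    = ℕ.z≤n
dbl-≥ (suc n) = ℕ.s≤s (ℕ.m≤n⇒m≤1+n (dbl-≥ n))

data Parity : ℕ → Set where
  even : ∀ k → Parity (dbl k)
  odd  : ∀ k → Parity (suc (dbl k))

parity : ∀ n → Parity n
parity zero          = even 0
parity (suc n) with parity n
... | even k = odd k
... | odd  k = even (suc k)

⌈/2⌉-⌊/2⌋ : ∀ n → (⌈ n /2⌉ ≡ ⌊ n /2⌋) ⊎ (⌈ n /2⌉ ≡ suc ⌊ n /2⌋)
⌈/2⌉-⌊/2⌋ zero          = inj₁ refl
⌈/2⌉-⌊/2⌋ (suc zero)    = inj₂ refl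
⌈/2⌉-⌊/2⌋ (suc (suc n)) with ⌈/2⌉-⌊/2⌋ n
... | inj₁ eq = inj₁ (cong suc eq)
... | inj₂ eq = inj₂ (cong suc eq)

-- Polynomials as coefficient vectors, paired with sequences.

-- The coefficient of t⁻¹⁻ᵐ in q(t) · Σ f(n) t⁻¹⁻ⁿ, the polynomial q being
-- given by its coefficients in increasing order of degree.
pair : (ℕ → ℚ) → Vec ℚ n → ℕ → ℚ
pair f []      m = 0ℚ
pair f (c ∷ q) m = c * f m + pair f q (suc m)

comb : ℚ → ℚ → Vec ℚ n → Vec ℚ n → Vec ℚ n
comb α β = zipWith (λ x y → α * x + β * y)

scale : ℚ → Vec ℚ n → Vec ℚ n
scale α = map (α *_)

Null : Vec ℚ n → Set
Null = All (_≡ 0ℚ)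

pair-comb : ∀ f α β (X Y : Vec ℚ n) m →
            pair f (comb α β X Y) m ≡ α * pair f X m + β * pair f Y m
pair-comb f α β [] [] m =
  solve 2 (λ a b → con 0ℚ := a :* con 0ℚ :+ b :* con 0ℚ) refl α β
pair-comb f α β (x ∷ X) (y ∷ Y) m =
  trans (cong ((α * x + β * y) * f m +_) (pair-comb f α β X Y (suc m)))
        (solve 7 (λ a b x y z p q → (a :* x :+ b :* y) :* z :+ (a :* p :+ b :* q)
                   := a :* (x :* z :+ p) :+ b :* (y :* z :+ q))
           refl α β x y (f m) (pair f X (suc m)) (pair f Y (suc m)))

pair-scale : ∀ f α (X : Vec ℚ n) m → pair f (scale α X) m ≡ α * pair f X m
pair-scale f α []      m = sym (*-zeroʳ α)
pair-scale f α (x ∷ X) m =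
  trans (cong (α * x * f m +_) (pair-scale f α X (suc m)))
        (solve 4 (λ a x z p → a :* x :* z :+ a :* p := a :* (x :* z :+ p))
           refl α x (f m) (pair f X (suc m)))

pair-∷ʳ : ∀ f (X : Vec ℚ n) z m → pair f (X ∷ʳ z) m ≡ pair f X m + z * f (n ℕ.+ m)
pair-∷ʳ f [] z m =
  solve 1 (λ x → x :+ con 0ℚ := con 0ℚ :+ x) refl (z * f m)
pair-∷ʳ {suc n} f (x ∷ X) z m = begin
  x * f m + pair f (X ∷ʳ z) (suc m)
    ≡⟨ cong (x * f m +_) (pair-∷ʳ f X z (suc m)) ⟩
  x * f m + (pair f X (suc m) + z * f (n ℕ.+ suc m))
    ≡⟨ cong (λ i → x * f m + (pair f X (suc m) + z * f i)) (ℕ.+-suc n m) ⟩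
  x * f m + (pair f X (suc m) + z * f (suc n ℕ.+ m))
    ≡⟨ solve 3 (λ a b c → a :+ (b :+ c) := a :+ b :+ c) refl
         (x * f m) (pair f X (suc m)) (z * f (suc n ℕ.+ m)) ⟩
  x * f m + pair f X (suc m) + z * f (suc n ℕ.+ m) ∎

pair-∷ʳ0 : ∀ f (X : Vec ℚ n) m → pair f (X ∷ʳ 0ℚ) m ≡ pair f X m
pair-∷ʳ0 {n} f X m = trans (pair-∷ʳ f X 0ℚ m)
  (solve 2 (λ p z → p :+ con 0ℚ :* z := p) refl (pair f X m) (f (n ℕ.+ m)))

pair-Null : ∀ f {X : Vec ℚ n} → Null X → ∀ m → pair f X m ≡ 0ℚ
pair-Null f []         m = refl
pair-Null f (refl ∷ X) m =
  trans (cong (0ℚ * f m +_) (pair-Null f X (suc m)))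
        (solve 1 (λ z → con 0ℚ :* z :+ con 0ℚ := con 0ℚ) refl (f m))

Null-replicate : ∀ n → Null (replicate n 0ℚ)
Null-replicate zero    = []
Null-replicate (suc n) = refl ∷ Null-replicate n

Null-∷ʳ : {X : Vec ℚ n} → Null X → Null (X ∷ʳ 0ℚ)
Null-∷ʳ []      = refl ∷ []
Null-∷ʳ (x ∷ X) = x ∷ Null-∷ʳ X

-- Evaluation is the pairing with a geometric sequence, so that the linearity lemmas for `pair`
-- serve values and Laurent coefficients alike.
eval : ℚ → Vec ℚ n → ℚ
eval y q = pair (y ^_) q 0

pair-^-suc : ∀ y (q : Vec ℚ n) m → pair (y ^_) q (suc m) ≡ y * pair (y ^_) q m
pair-^-suc y []      m = sym (*-zeroʳ y)
pair-^-suc y (c ∷ q) m =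
  trans (cong (c * (y * y ^ m) +_) (pair-^-suc y q (suc m)))
        (solve 4 (λ c y z p → c :* (y :* z) :+ y :* p := y :* (c :* z :+ p))
           refl c y (y ^ m) (pair (y ^_) q (suc m)))

eval-∷ : ∀ y c (q : Vec ℚ n) → eval y (c ∷ q) ≡ c + y * eval y q
eval-∷ y c q = cong₂ _+_ (*-identityʳ c) (pair-^-suc y q 0)

-- Runs of vanishing coefficients, and their splitting by parity.

Vanish : (ℕ → ℚ) → ℕ → ℕ → Set
Vanish f k zero    = ⊤
Vanish f k (suc n) = f k ≡ 0ℚ × Vanish f (suc k) n

Vanish-map : ∀ {f h : ℕ → ℚ} → (∀ m → f m ≡ 0ℚ → h m ≡ 0ℚ) →
             ∀ k n → Vanish f k n → Vanish h k n
Vanish-map f⇒h k zero    _       = tt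
Vanish-map f⇒h k (suc n) (p , r) = f⇒h k p , Vanish-map f⇒h (suc k) n r

Vanish-zip : ∀ {f g h : ℕ → ℚ} → (∀ m → f m ≡ 0ℚ → g m ≡ 0ℚ → h m ≡ 0ℚ) →
             ∀ k n → Vanish f k n → Vanish g k n → Vanish h k n
Vanish-zip fg⇒h k zero    _       _       = tt
Vanish-zip fg⇒h k (suc n) (p , r) (q , s) = fg⇒h k p q , Vanish-zip fg⇒h (suc k) n r s

Vanish-suc : ∀ {f h : ℕ → ℚ} → (∀ m → f (suc m) ≡ 0ℚ → h m ≡ 0ℚ) →
             ∀ k n → Vanish f (suc k) n → Vanish h k n
Vanish-suc f⇒h k zero    _       = tt
Vanish-suc f⇒h k (suc n) (p , r) = f⇒h k p , Vanish-suc f⇒h (suc k) n r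

Vanish-const : ∀ {f : ℕ → ℚ} → (∀ m → f m ≡ 0ℚ) → ∀ k n → Vanish f k n
Vanish-const f≡0 k zero    = tt
Vanish-const f≡0 k (suc n) = f≡0 k , Vanish-const f≡0 (suc k) n

comb≡0 : ∀ α β {x y} → x ≡ 0ℚ → y ≡ 0ℚ → α * x + β * y ≡ 0ℚ
comb≡0 α β refl refl = solve 2 (λ a b → a :* con 0ℚ :+ b :* con 0ℚ := con 0ℚ) refl α β

module Interleave (f a b : ℕ → ℚ)
  (f-even : ∀ m → f (dbl m) ≡ a m) (f-odd : ∀ m → f (suc (dbl m)) ≡ b m) where

  unzip-even : ∀ k n → Vanish f (dbl k) n → Vanish a k ⌈ n /2⌉ × Vanish b k ⌊ n /2⌋
  unzip-even k zero          _           = tt , tt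
  unzip-even k (suc zero)    (p , _)     = (trans (sym (f-even k)) p , tt) , tt
  unzip-even k (suc (suc n)) (p , q , r) with unzip-even (suc k) n r
  ... | s , t = (trans (sym (f-even k)) p , s) , (trans (sym (f-odd k)) q , t)

  -- An odd start `2k + 1` meets `b` first, so the run of `a` begins at `k + 1`.
  unzip-odd : ∀ k n → Vanish f (suc (dbl k)) n → Vanish b k ⌈ n /2⌉ × Vanish a (suc k) ⌊ n /2⌋
  unzip-odd k zero          _           = tt , tt
  unzip-odd k (suc zero)    (p , _)     = (trans (sym (f-odd k)) p , tt) , tt
  unzip-odd k (suc (suc n)) (p , q , r) with unzip-odd (suc k) n r
  ... | s , t = (trans (sym (f-odd k)) p , s) , (trans (sym (f-even (suc k))) q , t)

  zip-even : ∀ k n → Vanish a k ⌈ n /2⌉ → Vanish b k ⌊ n /2⌋ → Vanish f (dbl k) n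
  zip-even k zero          _       _       = tt
  zip-even k (suc zero)    (p , _) _       = trans (f-even k) p , tt
  zip-even k (suc (suc n)) (p , s) (q , t) =
    trans (f-even k) p , trans (f-odd k) q , zip-even (suc k) n s t

  zip-odd : ∀ k n → Vanish b k ⌈ n /2⌉ → Vanish a (suc k) ⌊ n /2⌋ → Vanish f (suc (dbl k)) n
  zip-odd k zero          _       _       = tt
  zip-odd k (suc zero)    (p , _) _       = trans (f-odd k) p , tt
  zip-odd k (suc (suc n)) (p , s) (q , t) =
    trans (f-odd k) p , trans (f-even (suc k)) q , zip-odd (suc k) n s t

-- From approximants to nonsingular Hankel matrices, by even and odd parts.

module Digits (u v : ℚ) (vu≡1 : v * u ≡ 1ℚ) (w : ℕ → ℚ)
  (w-even : ∀ n → w (dbl n) ≡ w n) (w-odd : ∀ n → w (suc (dbl n)) ≡ u * w n)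
  (w≢0 : ∀ n → w n ≢ 0ℚ) where

  u≢0 : u ≢ 0ℚ
  u≢0 = invertible⇒≢0 u v vu≡1

  -- The coefficients of (t + u) q(t) in odd degrees. The name refers to the even indices at which
  -- this polynomial computes the pairing of `w` with `q`.
  atEven : Vec ℚ n → Vec ℚ ⌈ n /2⌉
  atEven []          = []
  atEven (c ∷ [])    = c ∷ []
  atEven (c ∷ d ∷ q) = c + u * d ∷ atEven q

  -- The argument `h` is the coefficient preceding those of `q`, carried along by the recursion; it
  -- is 0 at the start. The lengths ⌈n/2⌉ and ⌊n/2⌋ + 1 share out the n + 1 coefficients of (t + u)
  -- q(t).
  atOdd : ℚ → Vec ℚ n → Vec ℚ (suc ⌊ n /2⌋)
  atOdd h []          = h ∷ []
  atOdd h (c ∷ [])    = h + u * c ∷ []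
  atOdd h (c ∷ d ∷ q) = h + u * c ∷ atOdd d q

  pair-atEven : ∀ (q : Vec ℚ n) m → pair w q (dbl m) ≡ pair w (atEven q) m
  pair-atEven []          m = refl
  pair-atEven (c ∷ [])    m = cong (λ z → c * z + 0ℚ) (w-even m)
  pair-atEven (c ∷ d ∷ q) m = begin
    c * w (dbl m) + (d * w (suc (dbl m)) + pair w q (dbl (suc m)))
      ≡⟨ cong₂ _+_ (cong (c *_) (w-even m))
                   (cong₂ _+_ (cong (d *_) (w-odd m)) (pair-atEven q (suc m))) ⟩
    c * w m + (d * (u * w m) + pair w (atEven q) (suc m))
      ≡⟨ solve 5 (λ c d u z p → c :* z :+ (d :* (u :* z) :+ p) := (c :+ u :* d) :* z :+ p)
           refl c d u (w m) (pair w (atEven q) (suc m)) ⟩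
    (c + u * d) * w m + pair w (atEven q) (suc m) ∎

  pair-atOdd : ∀ h (q : Vec ℚ n) m → pair w (atOdd h q) m ≡ h * w m + pair w q (suc (dbl m))
  pair-atOdd h []          m = refl
  pair-atOdd h (c ∷ [])    m =
    trans (solve 4 (λ h u c z → (h :+ u :* c) :* z :+ con 0ℚ := h :* z :+ (c :* (u :* z) :+ con 0ℚ))
             refl h u c (w m))
          (cong (λ z → h * w m + (c * z + 0ℚ)) (sym (w-odd m)))
  pair-atOdd h (c ∷ d ∷ q) m = begin
    (h + u * c) * w m + pair w (atOdd d q) (suc m)
      ≡⟨ cong ((h + u * c) * w m +_) (pair-atOdd d q (suc m)) ⟩
    (h + u * c) * w m + (d * w (suc m) + pair w q (suc (dbl (suc m))))
      ≡⟨ solve 5 (λ h u c z p → (h :+ u :* c) :* z :+ p := h :* z :+ (c :* (u :* z) :+ p))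
           refl h u c (w m) (d * w (suc m) + pair w q (suc (dbl (suc m)))) ⟩
    h * w m + (c * (u * w m) + (d * w (suc m) + pair w q (suc (dbl (suc m)))))
      ≡⟨ cong (h * w m +_) (cong₂ _+_ (cong (c *_) (sym (w-odd m)))
           (cong (_+ pair w q (suc (dbl (suc m)))) (cong (d *_) (sym (w-even (suc m)))))) ⟩
    h * w m + (c * w (suc (dbl m)) + (d * w (dbl (suc m)) + pair w q (suc (dbl (suc m))))) ∎

  pair-atOdd0 : ∀ (q : Vec ℚ n) m → pair w q (suc (dbl m)) ≡ pair w (atOdd 0ℚ q) m
  pair-atOdd0 q m = sym (trans (pair-atOdd 0ℚ q m)
    (solve 2 (λ z p → con 0ℚ :* z :+ p := p) refl (w m) (pair w q (suc (dbl m)))))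

  -- (t + u) q(t) = A(t²) + t B(t²) with A = atOdd 0 q and B = atEven q; now put t = - u.
  eval-atOdd : ∀ h (q : Vec ℚ n) → eval (u * u) (atOdd h q) ≡ h + u * eval (u * u) (atEven q)
  eval-atOdd h [] = trans (eval-∷ (u * u) h [])
    (solve 2 (λ h u → h :+ u :* u :* con 0ℚ := h :+ u :* con 0ℚ) refl h u)
  eval-atOdd h (c ∷ []) = begin
    eval (u * u) (h + u * c ∷ [])  ≡⟨ eval-∷ (u * u) (h + u * c) [] ⟩
    h + u * c + u * u * 0ℚ         ≡⟨ solve 3 (λ h u c → h :+ u :* c :+ u :* u :* con 0ℚ
                                        := h :+ u :* (c :+ u :* u :* con 0ℚ)) refl h u c ⟩
    h + u * (c + u * u * 0ℚ)       ≡⟨ cong (λ x → h + u * x) (sym (eval-∷ (u * u) c [])) ⟩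
    h + u * eval (u * u) (c ∷ [])  ∎
  eval-atOdd h (c ∷ d ∷ q) = begin
    eval (u * u) (h + u * c ∷ atOdd d q)
      ≡⟨ eval-∷ (u * u) (h + u * c) (atOdd d q) ⟩
    h + u * c + u * u * eval (u * u) (atOdd d q)
      ≡⟨ cong (λ x → h + u * c + u * u * x) (eval-atOdd d q) ⟩
    h + u * c + u * u * (d + u * eval (u * u) (atEven q))
      ≡⟨ solve 5 (λ h u c d e → h :+ u :* c :+ u :* u :* (d :+ u :* e)
           := h :+ u :* (c :+ u :* d :+ u :* u :* e)) refl h u c d (eval (u * u) (atEven q)) ⟩
    h + u * (c + u * d + u * u * eval (u * u) (atEven q))
      ≡⟨ cong (λ x → h + u * x) (sym (eval-∷ (u * u) (c + u * d) (atEven q))) ⟩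
    h + u * eval (u * u) (atEven (c ∷ d ∷ q)) ∎

  0+u*c≡0⇒c≡0 : ∀ {h} c → h ≡ 0ℚ → h + u * c ≡ 0ℚ → c ≡ 0ℚ
  0+u*c≡0⇒c≡0 c refl eq = *≡0⇒≡0 c u
    (trans (solve 2 (λ u c → c :* u := con 0ℚ :+ u :* c) refl u c) eq) u≢0

  -- As u ≠ 0, the coefficients of `q` are read off in order from entries of `A` and `B`
  -- alternately, each one once its predecessor is known to be 0.
  Null-split : ∀ {h} (q : Vec ℚ n) → h ≡ 0ℚ → Null (atEven q) → Null (atOdd h q) → Null q
  Null-split []          h≡0 _          _          = []
  Null-split (c ∷ [])    h≡0 (c≡0 ∷ _)  _          = c≡0 ∷ []
  Null-split (c ∷ d ∷ q) h≡0 (b ∷ B)    (a ∷ A)    = c≡0 ∷ d≡0 ∷ Null-split q d≡0 B A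
    where c≡0 = 0+u*c≡0⇒c≡0 c h≡0 a
          d≡0 = 0+u*c≡0⇒c≡0 d c≡0 b

  -- Triviality of the kernel of the n × n Hankel matrix with entries w(k + i + j).
  Nondeg : ℕ → ℕ → Set
  Nondeg n k = (q : Vec ℚ n) → Vanish (pair w q) k n → Null q

  -- A kernel vector of the n × (n + 1) Hankel matrix. Under `Nondeg n k` these form a line, so that
  -- P(u²) ≠ 0 becomes a statement about all of them.
  Approx : ℕ → ℕ → Set
  Approx n k = Σ (Vec ℚ (suc n)) λ P → Vanish (pair w P) k n × eval (u * u) P ≢ 0ℚ

  -- A is proportional to the approximant P, which does not vanish at u².
  approx-unique : ∀ e k → Nondeg e k → Approx e k → (A : Vec ℚ (suc e)) →
                  Vanish (pair w A) k e → eval (u * u) A ≡ 0ℚ → Null A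
  approx-unique e k nd (P , vP , P≢0) A vA A≡0 with initLast P | initLast A
  ... | P′ , p , refl | A′ , a , refl = subst (λ z → Null (A′ ∷ʳ z)) (sym a≡0)
          (Null-∷ʳ (nd A′ (Vanish-map (λ m eq → trans (sym (pair-∷ʳ0 w A′ m))
             (subst (λ z → pair w (A′ ∷ʳ z) m ≡ 0ℚ) a≡0 eq)) k e vA)))
    where
    -- In p A - a P the top coefficients cancel, so it fits into length e, where `nd` applies.
    C = comb p (- a) A′ P′

    top-cancels : ∀ f m → pair f C m ≡ p * pair f (A′ ∷ʳ a) m + (- a) * pair f (P′ ∷ʳ p) m
    top-cancels f m = begin
      pair f C m ≡⟨ pair-comb f p (- a) A′ P′ m ⟩
      p * pair f A′ m + (- a) * pair f P′ m
        ≡⟨ solve 5 (λ p a x y z → p :* x :+ (:- a) :* y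
             := p :* (x :+ a :* z) :+ (:- a) :* (y :+ p :* z)) refl
             p a (pair f A′ m) (pair f P′ m) (f (e ℕ.+ m)) ⟩
      p * (pair f A′ m + a * f (e ℕ.+ m)) + (- a) * (pair f P′ m + p * f (e ℕ.+ m))
        ≡⟨ sym (cong₂ (λ x y → p * x + (- a) * y) (pair-∷ʳ f A′ a m) (pair-∷ʳ f P′ p m)) ⟩
      p * pair f (A′ ∷ʳ a) m + (- a) * pair f (P′ ∷ʳ p) m ∎

    C-null : Null C
    C-null = nd C (Vanish-zip (λ m x y → trans (top-cancels w m) (comb≡0 p (- a) x y)) k e vA vP)

    -- At u² the relation p A = a P reads 0 = a P(u²). Once a = 0, `A` itself fits into length e.
    a≡0 : a ≡ 0ℚ
    a≡0 = *≡0⇒≡0 a (eval (u * u) (P′ ∷ʳ p)) (begin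
      a * eP                         ≡⟨ solve 3 (λ a e p → a :* e := p :* con 0ℚ :- (p :* con 0ℚ :+ (:- a) :* e))
                                          refl a eP p ⟩
      p * 0ℚ - (p * 0ℚ + (- a) * eP) ≡⟨ cong (λ x → p * 0ℚ - (p * x + (- a) * eP)) (sym A≡0) ⟩
      p * 0ℚ - (p * eval (u * u) (A′ ∷ʳ a) + (- a) * eP)
        ≡⟨ cong (λ x → p * 0ℚ - x) (trans (sym (top-cancels _ 0)) (pair-Null _ C-null 0)) ⟩
      p * 0ℚ - 0ℚ                    ≡⟨ solve 1 (λ p → p :* con 0ℚ :- con 0ℚ := con 0ℚ) refl p ⟩
      0ℚ                             ∎) P≢0
      where eP = eval (u * u) (P′ ∷ʳ p)

  eval-atOdd0 : ∀ (q : Vec ℚ n) → eval (u * u) (atOdd 0ℚ q) ≡ u * eval (u * u) (atEven q)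
  eval-atOdd0 q = trans (eval-atOdd 0ℚ q) (+-identityˡ _)

  eval-odd≡0 : (q : Vec ℚ n) → Null (atEven q) → eval (u * u) (atOdd 0ℚ q) ≡ 0ℚ
  eval-odd≡0 q null = trans (eval-atOdd0 q) (trans (cong (u *_) (pair-Null _ null 0)) (*-zeroʳ u))

  eval-even≡0 : (q : Vec ℚ n) → Null (atOdd 0ℚ q) → eval (u * u) (atEven q) ≡ 0ℚ
  eval-even≡0 q null = *≡0⇒≡0 _ u
    (trans (*-comm _ u) (trans (sym (eval-atOdd0 q)) (pair-Null _ null 0))) u≢0

  -- `B` has as many coefficients as equations, so it is null. Then A(u²) = u B(u²) = 0, and `A`,
  -- with one coefficient more than equations, is settled by the approximant.
  nondeg-even : ∀ n k → Nondeg ⌈ n /2⌉ k → Nondeg ⌊ n /2⌋ k → Approx ⌊ n /2⌋ k → Nondeg n (dbl k)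
  nondeg-even n k nd nd′ ap q van with unzip-even k n van
    where open Interleave (pair w q) (pair w (atEven q)) (pair w (atOdd 0ℚ q)) (pair-atEven q) (pair-atOdd0 q)
  ... | vB , vA = Null-split q refl nB
                    (approx-unique ⌊ n /2⌋ k nd′ ap (atOdd 0ℚ q) vA (eval-odd≡0 q nB))
    where nB = nd (atEven q) vB

  -- The parity of n decides which half has as many equations as coefficients: `B` for even n, `A`
  -- for odd n. The other half has one equation fewer and is left to `approx-unique`.
  nondeg-odd : ∀ n k → (∀ k → Nondeg ⌈ n /2⌉ k) → (∀ k → Nondeg ⌊ n /2⌋ k) →
               (∀ k → Approx ⌊ n /2⌋ k) → Nondeg n (suc (dbl k))
  nondeg-odd n k nd nd′ ap q van with unzip-odd k n van
    where open Interleave (pair w q) (pair w (atEven q)) (pair w (atOdd 0ℚ q)) (pair-atEven q) (pair-atOdd0 q)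
  ... | vA , vB = let nB , nA = nulls (⌈/2⌉-⌊/2⌋ n) nd nd′ ap (atOdd 0ℚ q) (atEven q) vA vB
                                  (eval-odd≡0 q) (eval-even≡0 q)
                  in Null-split q refl nB nA
    where
    -- Variables a and b replace the two halves of n, so that the equation between them can be
    -- matched with `refl`.
    nulls : ∀ {a b} → (a ≡ b) ⊎ (a ≡ suc b) →
            (∀ k → Nondeg a k) → (∀ k → Nondeg b k) → (∀ k → Approx b k) →
            (A : Vec ℚ (suc b)) (B : Vec ℚ a) →
            Vanish (pair w A) k a → Vanish (pair w B) (suc k) b →
            (Null B → eval (u * u) A ≡ 0ℚ) → (Null A → eval (u * u) B ≡ 0ℚ) → Null B × Null A
    nulls {a} (inj₁ refl) nd nd′ ap A B vA vB eA eB =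
      nB , approx-unique a k (nd k) (ap k) A vA (eA nB)
      where nB = nd (suc k) B vB
    nulls {a} {b} (inj₂ refl) nd nd′ ap A B vA vB eA eB =
      approx-unique b (suc k) (nd′ (suc k)) (ap (suc k)) B vB (eB nA) , nA
      where nA = nd k A vA

  nondeg-0 : ∀ k → Nondeg 0 k
  nondeg-0 k [] _ = []

  nondeg-1 : ∀ k → Nondeg 1 k
  nondeg-1 k (c ∷ []) (eq , _) =
    *≡0⇒≡0 c (w k) (trans (sym (+-identityʳ (c * w k))) eq) (w≢0 k) ∷ []

  nondeg : (∀ n k → Approx n k) → ∀ n k → Nondeg n k
  nondeg ap = <-rec (λ n → ∀ k → Nondeg n k) step
    where
    step : ∀ n → (∀ {m} → m ℕ.< n → ∀ k → Nondeg m k) → ∀ k → Nondeg n k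
    step zero          _   k = nondeg-0 k
    -- Since ⌈1/2⌉ = 1, halving does not descend at n = 1.
    step (suc zero)    _   k = nondeg-1 k
    step n@(suc (suc n′)) rec k with parity k
    ... | even j = nondeg-even n j (rec (ℕ.⌈n/2⌉<n n′) j) (rec (ℕ.⌊n/2⌋<n (suc n′)) j) (ap ⌊ n /2⌋ j)
    ... | odd  j = nondeg-odd n j (rec (ℕ.⌈n/2⌉<n n′)) (rec (ℕ.⌊n/2⌋<n (suc n′))) (ap ⌊ n /2⌋)

-- Subrings of ℚ with `a` in the Jacobson radical, and polynomials with weighted coefficients.

record IsLocal (a : ℚ) (R : ℚ → Set) : Set where
  field
    R0   : R 0ℚ
    R1   : R 1ℚ
    R+   : ∀ {x y} → R x → R y → R (x + y)
    R*   : ∀ {x y} → R x → R y → R (x * y)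
    R-   : ∀ {x} → R x → R (- x)
    Ra   : R a
    unit : ∀ {x} → R x → ∃ λ y → y * (1ℚ + a * x) ≡ 1ℚ × R y

module Weighted {a R} (isLocal : IsLocal a R) where
  open IsLocal isLocal

  -- The condition r q(s x) ∈ R[x].
  Weights : ℚ → ℚ → Vec ℚ n → Set
  Weights r s []      = ⊤
  Weights r s (c ∷ q) = R (r * c) × Weights (r * s) s q

  W-resp : ∀ {r r′} s (q : Vec ℚ n) → r ≡ r′ → Weights r s q → Weights r′ s q
  W-resp s q refl W = W

  W-replicate0 : ∀ r s n → Weights r s (replicate n 0ℚ)
  W-replicate0 r s zero    = tt
  W-replicate0 r s (suc n) = subst R (sym (*-zeroʳ r)) R0 , W-replicate0 (r * s) s n

  W-∷ʳ0 : ∀ r s (q : Vec ℚ n) → Weights r s q → Weights r s (q ∷ʳ 0ℚ)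
  W-∷ʳ0 r s []      _       = subst R (sym (*-zeroʳ r)) R0 , tt
  W-∷ʳ0 r s (c ∷ q) (x , W) = x , W-∷ʳ0 (r * s) s q W

  W-comb : ∀ r s α β (X Y : Vec ℚ n) → Weights (r * α) s X → Weights (r * β) s Y →
           Weights r s (comb α β X Y)
  W-comb r s α β []      []      _       _       = tt
  W-comb r s α β (x ∷ X) (y ∷ Y) (p , P) (q , Q) =
    subst R (solve 5 (λ r a b x y → r :* a :* x :+ r :* b :* y := r :* (a :* x :+ b :* y))
               refl r α β x y) (R+ p q) ,
    W-comb (r * s) s α β X Y (W-resp s X (swap α) P) (W-resp s Y (swap β) Q)
    where
    swap : ∀ z → r * z * s ≡ r * s * z
    swap z = solve 3 (λ r s z → r :* z :* s := r :* s :* z) refl r s z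

  W-scale : ∀ r s α (X : Vec ℚ n) → Weights (r * α) s X → Weights r s (scale α X)
  W-scale r s α []      _       = tt
  W-scale r s α (x ∷ X) (p , P) =
    subst R (*-assoc r α x) p ,
    W-scale (r * s) s α X (W-resp s X (solve 3 (λ r s z → r :* z :* s := r :* s :* z) refl r s α) P)

  W-mult : ∀ r s {t z} (X : Vec ℚ n) → R t → R z → Weights r s X → Weights (t * r) (z * s) X
  W-mult r s         []      Rt Rz _       = tt
  W-mult r s {t} {z} (x ∷ X) Rt Rz (p , P) =
    subst R (sym (*-assoc t r x)) (R* Rt p) ,
    W-resp (z * s) X (solve 4 (λ r s t z → t :* z :* (r :* s) := t :* r :* (z :* s)) refl r s t z)
      (W-mult (r * s) s X (R* Rt Rz) Rz P)

-- Approximants built by running the splitting backwards.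

module Approximants (u v : ℚ) (vu≡1 : v * u ≡ 1ℚ) (w : ℕ → ℚ)
  (w-even : ∀ n → w (dbl n) ≡ w n) (w-odd : ∀ n → w (suc (dbl n)) ≡ u * w n)
  (w≢0 : ∀ n → w n ≢ 0ℚ) {R} (isLocal : IsLocal u R) where

  open IsLocal isLocal
  open Weighted isLocal
  open Digits u v vu≡1 w w-even w-odd w≢0

  y : ℚ
  y = u * u

  cancel : ∀ x → v * (u * x) ≡ x
  cancel x = trans (sym (*-assoc v u x)) (trans (cong (_* x) vu≡1) (*-identityˡ x))

  cancel′ : ∀ x → u * (v * x) ≡ x
  cancel′ x = trans (solve 3 (λ u v x → u :* (v :* x) := v :* (u :* x)) refl u v x) (cancel x)

  -- The q with atOdd h q = A and atEven q = B, which exists when A(u²) = h + u B(u²).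
  unsplit : ∀ n → ℚ → Vec ℚ (suc ⌊ n /2⌋) → Vec ℚ ⌈ n /2⌉ → Vec ℚ n
  unsplit zero          h _       _        = []
  unsplit (suc zero)    h _       (b ∷ []) = b ∷ []
  unsplit (suc (suc n)) h (a ∷ A) (b ∷ B)  = c ∷ d ∷ unsplit n d A B
    where c = v * (a - h)
          d = v * (b - c)

  Compat : ∀ n → ℚ → Vec ℚ (suc ⌊ n /2⌋) → Vec ℚ ⌈ n /2⌉ → Set
  Compat n h A B = eval y A ≡ h + u * eval y B

  u*c : ∀ a h → u * (v * (a - h)) + h ≡ a
  u*c a h = trans (cong (_+ h) (cancel′ (a - h)))
                  (solve 2 (λ a h → a :- h :+ h := a) refl a h)

  -- The lowest coefficients are split off and the relation is divided by u²; the new carry is v² (h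
  -- + u b - a).
  compat-step : ∀ n h a A b B → Compat (suc (suc n)) h (a ∷ A) (b ∷ B) →
                Compat n (v * (b - v * (a - h))) A B
  compat-step n h a A b B eq = begin
    eA                                    ≡⟨ sym (cancel eA) ⟩
    v * (u * eA)                          ≡⟨ cong (v *_) (sym (cancel (u * eA))) ⟩
    v * (v * (u * (u * eA)))              ≡⟨ solve 4 (λ v u a e → v :* (v :* (u :* (u :* e)))
                                               := v :* (v :* (a :+ u :* u :* e :- a))) refl v u a eA ⟩
    v * (v * (a + u * u * eA - a))        ≡⟨ cong (λ x → v * (v * (x - a)))
                                               (trans (sym (eval-∷ y a A)) (trans eq (cong (λ x → h + u * x) (eval-∷ y b B)))) ⟩
    v * (v * (h + u * (b + u * u * eB) - a))
      ≡⟨ solve 6 (λ v u h b a e → v :* (v :* (h :+ u :* (b :+ u :* u :* e) :- a))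
           := v :* (v :* (u :* b) :- v :* (a :- h)) :+ v :* (u :* (v :* (u :* (u :* e))))) refl v u h b a eB ⟩
    v * (v * (u * b) - v * (a - h)) + v * (u * (v * (u * (u * eB))))
      ≡⟨ cong₂ (λ x z → v * (x - v * (a - h)) + z) (cancel b)
           (trans (cancel (v * (u * (u * eB)))) (cancel (u * eB))) ⟩
    v * (b - v * (a - h)) + u * eB        ∎
    where eA = eval y A
          eB = eval y B

  unsplit-even : ∀ n h A B → Compat n h A B → ∀ m → pair w (unsplit n h A B) (dbl m) ≡ pair w B m
  unsplit-even zero          h A       []       eq m = refl
  unsplit-even (suc zero)    h A       (b ∷ []) eq m = cong (λ z → b * z + 0ℚ) (w-even m)
  unsplit-even (suc (suc n)) h (a ∷ A) (b ∷ B)  eq m = begin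
    c * w (dbl m) + (d * w (suc (dbl m)) + pair w (unsplit n d A B) (dbl (suc m)))
      ≡⟨ cong₂ _+_ (cong (c *_) (w-even m)) (cong₂ _+_ (cong (d *_) (w-odd m))
           (unsplit-even n d A B (compat-step n h a A b B eq) (suc m))) ⟩
    c * w m + (d * (u * w m) + pair w B (suc m))
      ≡⟨ solve 5 (λ c d u z p → c :* z :+ (d :* (u :* z) :+ p) := (u :* d :+ c) :* z :+ p)
           refl c d u (w m) (pair w B (suc m)) ⟩
    (u * d + c) * w m + pair w B (suc m)
      ≡⟨ cong (λ x → x * w m + pair w B (suc m)) (u*c b c) ⟩
    b * w m + pair w B (suc m) ∎
    where c = v * (a - h)
          d = v * (b - c)

  -- The relation a = h + u c matches the pairings term by term. Where the recursion ends, one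
  -- coefficient of `A` remains, and compatibility gives its value.
  unsplit-odd : ∀ n h A B → Compat n h A B →
                ∀ m → h * w m + pair w (unsplit n h A B) (suc (dbl m)) ≡ pair w A m
  unsplit-odd zero h (a ∷ []) [] eq m = cong (λ x → x * w m + 0ℚ) (sym a≡h)
    where
    a≡h : a ≡ h
    a≡h = begin
      a                  ≡⟨ solve 2 (λ a y → a := a :+ y :* con 0ℚ) refl a y ⟩
      a + y * 0ℚ         ≡⟨ sym (eval-∷ y a []) ⟩
      eval y (a ∷ [])    ≡⟨ eq ⟩
      h + u * 0ℚ         ≡⟨ solve 2 (λ h u → h :+ u :* con 0ℚ := h) refl h u ⟩
      h                  ∎
  unsplit-odd (suc zero) h (a ∷ []) (b ∷ []) eq m = begin
    h * w m + (b * w (suc (dbl m)) + 0ℚ) ≡⟨ cong (λ z → h * w m + (b * z + 0ℚ)) (w-odd m) ⟩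
    h * w m + (b * (u * w m) + 0ℚ)
      ≡⟨ solve 4 (λ h b u z → h :* z :+ (b :* (u :* z) :+ con 0ℚ) := (h :+ u :* (b :+ u :* u :* con 0ℚ)) :* z :+ con 0ℚ)
           refl h b u (w m) ⟩
    (h + u * (b + y * 0ℚ)) * w m + 0ℚ ≡⟨ cong (λ x → (h + u * x) * w m + 0ℚ) (sym (eval-∷ y b [])) ⟩
    (h + u * eval y (b ∷ [])) * w m + 0ℚ ≡⟨ cong (λ x → x * w m + 0ℚ) (sym eq) ⟩
    eval y (a ∷ []) * w m + 0ℚ ≡⟨ cong (λ x → x * w m + 0ℚ) (eval-∷ y a []) ⟩
    (a + y * 0ℚ) * w m + 0ℚ ≡⟨ solve 3 (λ a y z → (a :+ y :* con 0ℚ) :* z :+ con 0ℚ := a :* z :+ con 0ℚ) refl a y (w m) ⟩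
    a * w m + 0ℚ ∎
  unsplit-odd (suc (suc n)) h (a ∷ A) (b ∷ B) eq m = begin
    h * w m + (c * w (suc (dbl m)) + (d * w (dbl (suc m)) + p))
      ≡⟨ cong₂ (λ x z → h * w m + (c * x + (d * z + p))) (w-odd m) (w-even (suc m)) ⟩
    h * w m + (c * (u * w m) + (d * w (suc m) + p))
      ≡⟨ solve 5 (λ h c u z e → h :* z :+ (c :* (u :* z) :+ e) := (u :* c :+ h) :* z :+ e)
           refl h c u (w m) (d * w (suc m) + p) ⟩
    (u * c + h) * w m + (d * w (suc m) + p)
      ≡⟨ cong₂ (λ x z → x * w m + z) (u*c a h) (unsplit-odd n d A B (compat-step n h a A b B eq) (suc m)) ⟩
    a * w m + pair w A (suc m) ∎
    where c = v * (a - h)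
          d = v * (b - c)
          p = pair w (unsplit n d A B) (suc (dbl (suc m)))

  -- By r c = v r a - v r h and r u d = r b - r c the weighted coefficients lie in R, although v
  -- need not. The element r u d is also the weighted carry v (r u²) d of the next step.
  unsplit-weights : ∀ n r h A B → R (v * r * h) → Weights (v * r) y A → Weights r y B →
                    Weights r u (unsplit n h A B)
  unsplit-weights zero          r h A       B        Rh WA       WB       = tt
  unsplit-weights (suc zero)    r h A       (b ∷ []) Rh WA       (Rb , _) = Rb , tt
  unsplit-weights (suc (suc n)) r h (a ∷ A) (b ∷ B)  Rh (Ra , WA) (Rb , WB) =
    Rc , Rd , W-resp u (unsplit n d A B) (sym (*-assoc r u u))
      (unsplit-weights n (r * y) d A B
        (subst R (trans (sym (cancel (r * u * d)))
                 (solve 4 (λ v u r d → v :* (u :* (r :* u :* d)) := v :* (r :* (u :* u)) :* d) refl v u r d)) Rd)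
        (W-resp y A (*-assoc v r y) WA) WB)
    where
    c = v * (a - h)
    d = v * (b - c)
    Rc : R (r * c)
    Rc = subst R (solve 4 (λ v r a h → v :* r :* a :+ (:- (v :* r :* h)) := r :* (v :* (a :- h)))
                    refl v r a h) (R+ Ra (R- Rh))
    Rd : R (r * u * d)
    Rd = subst R (trans (cong (r *_) (sym (cancel′ (b - c)))) (sym (*-assoc r u d)))
           (subst R (solve 3 (λ r b c → r :* b :+ (:- (r :* c)) := r :* (b :- c)) refl r b c) (R+ Rb (R- Rc)))

  -- The strengthening of `Approx` that the induction carries: P(0) = 1 and P(ux) ∈ R[x] force P(u²)
  -- into 1 + uR.
  Good : ℕ → ℕ → Set
  Good n k = Σ (Vec ℚ (suc n)) λ P → head P ≡ 1ℚ × Vanish (pair w P) k n × Weights 1ℚ u P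

  -- The term of degree i, r c u^(2i), is the weighted coefficient r u^i c ∈ R times u^i ∈ R.
  R-eval : ∀ r (q : Vec ℚ n) → Weights r u q → R (r * eval y q)
  R-eval r []      _       = subst R (sym (*-zeroʳ r)) R0
  R-eval r (c ∷ q) (x , W) = subst R (begin
    r * c + r * u * eval y q * u  ≡⟨ solve 4 (λ r c u e → r :* c :+ r :* u :* e :* u
                                       := r :* (c :+ u :* u :* e)) refl r c u (eval y q) ⟩
    r * (c + y * eval y q)        ≡⟨ cong (r *_) (sym (eval-∷ y c q)) ⟩
    r * eval y (c ∷ q)            ∎) (R+ x (R* (R-eval (r * u) q W) Ra))

  eval-1+ : ∀ {n k} (g : Good n k) → ∃ λ x → R x × eval y (proj₁ g) ≡ 1ℚ + u * x
  eval-1+ (_ ∷ p , refl , _ , _ , W) = 1ℚ * u * eval y p , R-eval (1ℚ * u) p W ,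
    trans (eval-∷ y 1ℚ p) (solve 2 (λ u e → con 1ℚ :+ u :* u :* e := con 1ℚ :+ u :* (con 1ℚ :* u :* e))
                             refl u (eval y p))

  eval-unit : ∀ {n k} (g : Good n k) → ∃ λ z → R z × z * eval y (proj₁ g) ≡ 1ℚ
  eval-unit g with eval-1+ g
  ... | x , Rx , eq with unit Rx
  ...   | z , zeq , Rz = z , Rz , trans (cong (z *_) eq) zeq

  eval-R : ∀ {n k} (g : Good n k) → R (eval y (proj₁ g))
  eval-R g with eval-1+ g
  ... | x , Rx , eq = subst R (sym eq) (R+ R1 (R* Ra Rx))

  -- Values at u² are units of R, so one approximant can be rescaled within R to the value of
  -- another. This is how two halves are made compatible.
  quotient : ∀ {n k n′ k′} (g : Good n k) (g′ : Good n′ k′) →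
             ∃ λ σ → R σ × eval y (proj₁ g) ≡ σ * eval y (proj₁ g′)
  quotient g g′ with eval-unit g′
  ... | z , Rz , eq = e * z , R* (eval-R g) Rz ,
      sym (trans (*-assoc e z _) (trans (cong (e *_) eq) (*-identityʳ e)))
    where e = eval y (proj₁ g)

  weights-y : (X : Vec ℚ n) → ∀ {t} → R t → Weights 1ℚ u X → Weights t y X
  weights-y X {t} Rt W = W-resp y X (*-identityʳ t) (W-mult 1ℚ u X Rt Ra W)

  -- With h = 0 and first coefficient u of `A`, the assembled polynomial starts with v u = 1. The
  -- weights are those that `unsplit-weights` takes at r = 1.
  record Halves (a b kA nA kB nB : ℕ) : Set where
    field
      A       : Vec ℚ (suc a)
      B       : Vec ℚ (suc b)
      head-A  : head A ≡ u
      compat  : eval y A ≡ 0ℚ + u * eval y B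
      vanishA : Vanish (pair w A) kA nA
      vanishB : Vanish (pair w B) kB nB
      weightA : Weights v y A
      weightB : Weights 1ℚ y B

  scale≡0 : ∀ α (X : Vec ℚ n) m → pair w X m ≡ 0ℚ → pair w (scale α X) m ≡ 0ℚ
  scale≡0 α X m eq = trans (pair-scale w α X m) (trans (cong (α *_) eq) (*-zeroʳ α))

  head-scale : (X : Vec ℚ (suc n)) → head X ≡ 1ℚ → head (scale u X) ≡ u
  head-scale (_ ∷ _) refl = *-identityʳ u

  weights-scale : (X : Vec ℚ n) → Weights 1ℚ u X → Weights v y (scale u X)
  weights-scale X W = W-scale v y u X (W-resp y X (sym vu≡1) (weights-y X R1 W))

  -- The first coefficient forces A = u X; then B = σ Y with X(u²) = σ Y(u²) is compatible.
  halves-odd : ∀ {a b k} → Good a k → Good b (suc k) → Halves a b k a (suc k) b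
  halves-odd {a} {b} {k} gX@(X , hX , vX , wX) gY@(Y , hY , vY , wY) with quotient gX gY
  ... | σ , Rσ , eq = record
    { A       = scale u X
    ; B       = scale σ Y
    ; head-A  = head-scale X hX
    ; compat  = begin
        eval y (scale u X)             ≡⟨ pair-scale _ u X 0 ⟩
        u * eval y X                   ≡⟨ cong (u *_) (trans eq (sym (pair-scale _ σ Y 0))) ⟩
        u * eval y (scale σ Y)         ≡⟨ sym (+-identityˡ _) ⟩
        0ℚ + u * eval y (scale σ Y)    ∎
    ; vanishA = Vanish-map (scale≡0 u X) k a vX
    ; vanishB = Vanish-map (scale≡0 σ Y) (suc k) b vY
    ; weightA = weights-scale X wX
    ; weightB = W-scale 1ℚ y σ Y (weights-y Y (R* R1 Rσ) wY)
    }

  -- For a = b the choice A = u X, B = X is compatible. For a = b + 1 take B = 0; then `A` must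
  -- vanish at u² and is a combination of X and t Y, the factor t moving the run of Y from k + 1 to
  -- k.
  halves-even : ∀ {a b k} → (a ≡ b) ⊎ (a ≡ suc b) → Good b k → Good b (suc k) → Halves a b k b k a
  halves-even {b = b} {k} (inj₁ refl) (X , hX , vX , wX) _ = record
    { A       = scale u X
    ; B       = X
    ; head-A  = head-scale X hX
    ; compat  = trans (pair-scale _ u X 0) (sym (+-identityˡ _))
    ; vanishA = Vanish-map (scale≡0 u X) k b vX
    ; vanishB = vX
    ; weightA = weights-scale X wX
    ; weightB = weights-y X R1 wX
    }
  halves-even {b = b} {k} (inj₂ refl) gX@(X , hX , vX , wX) gY@(Y , hY , vY , wY) with quotient gX gY
  ... | σ , Rσ , eq = record
    { A       = A
    ; B       = replicate (suc b) 0ℚ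
    ; head-A  = head-A X hX
    ; compat  = begin
        eval y A                       ≡⟨ pair-A _ 0 ⟩
        u * eval y X + τ * (0ℚ * 1ℚ + pair (y ^_) Y 1)
          ≡⟨ cong (λ x → u * eval y X + τ * (0ℚ * 1ℚ + x)) (pair-^-suc y Y 0) ⟩
        u * eval y X + τ * (0ℚ * 1ℚ + y * eval y Y)
          ≡⟨ cong (λ x → u * x + τ * (0ℚ * 1ℚ + y * eval y Y)) eq ⟩
        u * (σ * eval y Y) + τ * (0ℚ * 1ℚ + y * eval y Y)
          ≡⟨ solve 4 (λ u v s e → u :* (s :* e) :+ (:- (v :* s)) :* (con 0ℚ :* con 1ℚ :+ u :* u :* e)
               := u :* (s :* e) :- v :* (u :* (u :* (s :* e)))) refl u v σ (eval y Y) ⟩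
        u * (σ * eval y Y) - v * (u * (u * (σ * eval y Y)))
          ≡⟨ cong (λ x → u * (σ * eval y Y) - x) (cancel _) ⟩
        u * (σ * eval y Y) - u * (σ * eval y Y)
          ≡⟨ solve 2 (λ x u → x :- x := con 0ℚ :+ u :* con 0ℚ) refl (u * (σ * eval y Y)) u ⟩
        0ℚ + u * 0ℚ
          ≡⟨ cong (λ x → 0ℚ + u * x) (sym (pair-Null (y ^_) (Null-replicate (suc b)) 0)) ⟩
        0ℚ + u * eval y (replicate (suc b) 0ℚ) ∎
    ; vanishA = Vanish-zip (λ m p q → trans (pair-A w m) (comb≡0 u τ p q)) k b vX
                  (Vanish-suc {h = pair w (0ℚ ∷ Y)} (λ m p → trans (cong (0ℚ * w m +_) p)
                    (solve 1 (λ z → con 0ℚ :* z :+ con 0ℚ := con 0ℚ) refl (w m))) k b vY)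
    ; vanishB = Vanish-const (pair-Null w (Null-replicate (suc b))) k (suc b)
    ; weightA = W-comb v y u τ (X ∷ʳ 0ℚ) (0ℚ ∷ Y)
                  (W-∷ʳ0 (v * u) y X (W-resp y X (sym vu≡1) (weights-y X R1 wX)))
                  -- Shifting Y by one degree multiplies its weight v τ by u², which turns it into
                  -- -σ ∈ R.
                  (subst R (sym (*-zeroʳ (v * τ))) R0 , W-resp y Y vτy (weights-y Y (R- Rσ) wY))
    ; weightB = W-replicate0 1ℚ y (suc b)
    }
    where
    -- The solution of u X(u²) + τ u² Y(u²) = 0, where X(u²) = σ Y(u²).
    τ = - (v * σ)
    A = comb u τ (X ∷ʳ 0ℚ) (0ℚ ∷ Y)

    pair-A : ∀ f m → pair f A m ≡ u * pair f X m + τ * pair f (0ℚ ∷ Y) m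
    pair-A f m = trans (pair-comb f u τ (X ∷ʳ 0ℚ) (0ℚ ∷ Y) m)
                       (cong (λ x → u * x + τ * pair f (0ℚ ∷ Y) m) (pair-∷ʳ0 f X m))

    head-A : (X : Vec ℚ (suc b)) → head X ≡ 1ℚ → head (comb u τ (X ∷ʳ 0ℚ) (0ℚ ∷ Y)) ≡ u
    head-A (_ ∷ _) refl = solve 2 (λ u t → u :* con 1ℚ :+ t :* con 0ℚ := u) refl u τ

    vτy : - σ ≡ v * τ * y
    vτy = sym (trans (solve 3 (λ u v s → v :* (:- (v :* s)) :* (u :* u) := v :* (u :* (v :* (u :* (:- s))))) refl u v σ)
                     (trans (cancel _) (cancel _)))

  assemble : ∀ n k {kA nA kB nB} (H : Halves ⌈ suc n /2⌉ ⌊ suc n /2⌋ kA nA kB nB) →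
    let q = unsplit (suc (suc n)) 0ℚ (Halves.A H) (Halves.B H) in
    ((∀ m → pair w q (dbl m) ≡ pair w (Halves.B H) m) →
     (∀ m → pair w q (suc (dbl m)) ≡ pair w (Halves.A H) m) → Vanish (pair w q) k (suc n)) →
    Good (suc n) k
  assemble n k H vanish = q , head-q A B head-A ,
    vanish (unsplit-even (suc (suc n)) 0ℚ A B compat)
      (λ m → trans (solve 2 (λ z p → p := con 0ℚ :* z :+ p) refl (w m) (pair w q (suc (dbl m))))
                   (unsplit-odd (suc (suc n)) 0ℚ A B compat m)) ,
    unsplit-weights (suc (suc n)) 1ℚ 0ℚ A B (subst R (sym (*-zeroʳ (v * 1ℚ))) R0)
      (W-resp y A (sym (*-identityʳ v)) weightA) weightB
    where
    open Halves H
    q = unsplit (suc (suc n)) 0ℚ A B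
    head-q : ∀ A B → head A ≡ u → head (unsplit (suc (suc n)) 0ℚ A B) ≡ 1ℚ
    head-q (_ ∷ _) (_ ∷ _) refl = trans (solve 2 (λ u v → v :* (u :- con 0ℚ) := v :* u) refl u v) vu≡1

  good-even : ∀ n k → Good ⌊ suc n /2⌋ k → Good ⌊ suc n /2⌋ (suc k) → Good (suc n) (dbl k)
  good-even n k gX gY = assemble n (dbl k) H
    (λ p q → Interleave.zip-even _ _ _ p q k (suc n) vanishB vanishA)
    where H = halves-even (⌈/2⌉-⌊/2⌋ (suc n)) gX gY
          open Halves H

  good-odd : ∀ n k → Good ⌈ suc n /2⌉ k → Good ⌊ suc n /2⌋ (suc k) → Good (suc n) (suc (dbl k))
  good-odd n k gX gY = assemble n (suc (dbl k)) H
    (λ p q → Interleave.zip-odd _ _ _ p q k (suc n) vanishA vanishB)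
    where H = halves-odd gX gY
          open Halves H

  good-0 : ∀ k → Good 0 k
  good-0 k = 1ℚ ∷ [] , refl , tt , R1 , tt

  -- As ⌈1/2⌉ = 1, an odd start 2j + 1 does not shorten the run; the start drops to j instead,
  -- whence the induction on k.
  good-1 : ∀ k → Good 1 k
  good-1 = <-rec (Good 1) step
    where
    step : ∀ k → (∀ {j} → j ℕ.< k → Good 1 j) → Good 1 k
    step k rec with parity k
    ... | even j = good-even 0 j (good-0 j) (good-0 (suc j))
    ... | odd  j = good-odd 0 j (rec (s≤s (dbl-≥ j))) (good-0 (suc j))

  good : ∀ n k → Good n k
  good = <-rec (λ n → ∀ k → Good n k) step
    where
    step : ∀ n → (∀ {m} → m ℕ.< n → ∀ k → Good m k) → ∀ k → Good n k
    step zero             _   = good-0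
    step (suc zero)       _   = good-1
    step (suc n@(suc n′)) rec k with parity k
    ... | even j = good-even n j (rec (ℕ.⌊n/2⌋<n n) j) (rec (ℕ.⌊n/2⌋<n n) (suc j))
    ... | odd  j = good-odd n j (rec (ℕ.⌈n/2⌉<n n′) j) (rec (ℕ.⌊n/2⌋<n n) (suc j))

  approx : ∀ n k → Approx n k
  approx n k with good n k
  ... | g@(P , _ , vP , _) with eval-unit g
  ...   | z , _ , eq = P , vP , invertible⇒≢0 _ z eq

  nondegenerate : ∀ n k → Nondeg n k
  nondegenerate = nondeg approx

-- The ring of fractions with denominator in 1 + aℤ.

ι : ℤ → ℚ
ι z = mkℚ z 0 (C.sym (C.1-coprimeTo _))

ι-+ : ∀ x y → ι x + ι y ≡ ι (x ℤ.+ y)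
ι-+ x y = trans (cong (_/ 1) (cong₂ ℤ._+_ (ℤ.*-identityʳ x) (ℤ.*-identityʳ y))) (↥p/↧p≡p (ι (x ℤ.+ y)))

ι-* : ∀ x y → ι x * ι y ≡ ι (x ℤ.* y)
ι-* x y = ↥p/↧p≡p (ι (x ℤ.* y))

ι-neg : ∀ x → - ι x ≡ ι (ℤ.- x)
ι-neg (ℤ.+ zero)  = refl
ι-neg (ℤ.+ suc n) = refl
ι-neg -[1+ n ]  = refl

module Localization (a : ℤ) (1+a*n≢0 : ∀ n → 1ℤ ℤ.+ a ℤ.* n ≢ 0ℤ) where

  den : ℤ → ℤ
  den n = 1ℤ ℤ.+ a ℤ.* n

  -- The fraction need not be in lowest terms, and its equation is multiplied out, so that the ring
  -- operations need no division.
  data R (x : ℚ) : Set where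
    frac : ∀ m n → x * ι (den n) ≡ ι m → R x

  den-* : ∀ n n′ → ι (den n) * ι (den n′) ≡ ι (den (n ℤ.+ n′ ℤ.+ a ℤ.* n ℤ.* n′))
  den-* n n′ = trans (ι-* (den n) (den n′)) (cong ι (identity a n n′))
    where
    identity : ∀ a n n′ → (1ℤ ℤ.+ a ℤ.* n) ℤ.* (1ℤ ℤ.+ a ℤ.* n′) ≡ 1ℤ ℤ.+ a ℤ.* (n ℤ.+ n′ ℤ.+ a ℤ.* n ℤ.* n′)
    identity = ℤ-Ring.solve-∀

  R-ι : ∀ m → R (ι m)
  R-ι m = frac m 0ℤ (trans (cong (λ z → ι m * ι (1ℤ ℤ.+ z)) (ℤ.*-zeroʳ a)) (*-identityʳ (ι m)))

  R+ : ∀ {x y} → R x → R y → R (x + y)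
  R+ {x} {y} (frac m n p) (frac m′ n′ p′) =
    frac (m ℤ.* den n′ ℤ.+ m′ ℤ.* den n) (n ℤ.+ n′ ℤ.+ a ℤ.* n ℤ.* n′) (begin
      (x + y) * ι (den (n ℤ.+ n′ ℤ.+ a ℤ.* n ℤ.* n′))   ≡⟨ cong ((x + y) *_) (sym (den-* n n′)) ⟩
      (x + y) * (ι (den n) * ι (den n′))
        ≡⟨ solve 4 (λ x y d e → (x :+ y) :* (d :* e) := x :* d :* e :+ y :* e :* d)
             refl x y (ι (den n)) (ι (den n′)) ⟩
      x * ι (den n) * ι (den n′) + y * ι (den n′) * ι (den n)
        ≡⟨ cong₂ (λ r s → r * ι (den n′) + s * ι (den n)) p p′ ⟩
      ι m * ι (den n′) + ι m′ * ι (den n)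
        ≡⟨ cong₂ _+_ (ι-* m (den n′)) (ι-* m′ (den n)) ⟩
      ι (m ℤ.* den n′) + ι (m′ ℤ.* den n)             ≡⟨ ι-+ (m ℤ.* den n′) (m′ ℤ.* den n) ⟩
      ι (m ℤ.* den n′ ℤ.+ m′ ℤ.* den n)               ∎)

  R* : ∀ {x y} → R x → R y → R (x * y)
  R* {x} {y} (frac m n p) (frac m′ n′ p′) =
    frac (m ℤ.* m′) (n ℤ.+ n′ ℤ.+ a ℤ.* n ℤ.* n′) (begin
      x * y * ι (den (n ℤ.+ n′ ℤ.+ a ℤ.* n ℤ.* n′))   ≡⟨ cong (x * y *_) (sym (den-* n n′)) ⟩
      x * y * (ι (den n) * ι (den n′))
        ≡⟨ solve 4 (λ x y d e → x :* y :* (d :* e) := x :* d :* (y :* e))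
             refl x y (ι (den n)) (ι (den n′)) ⟩
      x * ι (den n) * (y * ι (den n′))                ≡⟨ cong₂ _*_ p p′ ⟩
      ι m * ι m′                                      ≡⟨ ι-* m m′ ⟩
      ι (m ℤ.* m′)                                    ∎)

  R- : ∀ {x} → R x → R (- x)
  R- {x} (frac m n p) = frac (ℤ.- m) n (begin
    (- x) * ι (den n) ≡⟨ solve 2 (λ x d → (:- x) :* d := :- (x :* d)) refl x (ι (den n)) ⟩
    - (x * ι (den n)) ≡⟨ cong -_ p ⟩
    - ι m             ≡⟨ ι-neg m ⟩
    ι (ℤ.- m)         ∎)

  -- If x = m / (1 + a n), then 1 + a x = (1 + a (n + m)) / (1 + a n), and the inverse again has its
  -- denominator in 1 + aℤ.
  unit-a : ∀ {x} → R x → ∃ λ y → y * (1ℚ + ι a * x) ≡ 1ℚ × R y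
  unit-a {x} (frac m n p) = 1/ s , *-inverseˡ s , frac (den n) (n ℤ.+ m) (begin
      1/ s * ι (den (n ℤ.+ m)) ≡⟨ cong (1/ s *_) (sym s*den) ⟩
      1/ s * (s * ι (den n))   ≡⟨ sym (*-assoc (1/ s) s _) ⟩
      1/ s * s * ι (den n)     ≡⟨ cong (_* ι (den n)) (*-inverseˡ s) ⟩
      1ℚ * ι (den n)           ≡⟨ solve 1 (λ d → con 1ℚ :* d := d) refl (ι (den n)) ⟩
      ι (den n)                ∎)
    where
    s = 1ℚ + ι a * x
    s*den : s * ι (den n) ≡ ι (den (n ℤ.+ m))
    s*den = begin
      s * ι (den n)                  ≡⟨ solve 3 (λ a x d → (con 1ℚ :+ a :* x) :* d := d :+ a :* (x :* d))
                                          refl (ι a) x (ι (den n)) ⟩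
      ι (den n) + ι a * (x * ι (den n)) ≡⟨ cong (λ r → ι (den n) + ι a * r) p ⟩
      ι (den n) + ι a * ι m          ≡⟨ cong (λ r → ι (den n) + r) (ι-* a m) ⟩
      ι (den n) + ι (a ℤ.* m)        ≡⟨ ι-+ (den n) (a ℤ.* m) ⟩
      ι (den n ℤ.+ a ℤ.* m)          ≡⟨ cong ι (identity a n m) ⟩
      ι (den (n ℤ.+ m))              ∎
      where
      identity : ∀ a n m → 1ℤ ℤ.+ a ℤ.* n ℤ.+ a ℤ.* m ≡ 1ℤ ℤ.+ a ℤ.* (n ℤ.+ m)
      identity = ℤ-Ring.solve-∀
    s≢0 : s ≢ 0ℚ
    s≢0 s≡0 = 1+a*n≢0 (n ℤ.+ m) (cong ↥_ (begin
      ι (den (n ℤ.+ m)) ≡⟨ sym s*den ⟩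
      s * ι (den n)     ≡⟨ cong (_* ι (den n)) s≡0 ⟩
      0ℚ * ι (den n)    ≡⟨ *-zeroˡ (ι (den n)) ⟩
      0ℚ                ∎))
    instance _ = ≢-nonZero s≢0

  isLocal : ∀ {z} → R z → IsLocal (ι a * z) R
  isLocal {z} Rz = record
    { R0   = R-ι 0ℤ
    ; R1   = R-ι 1ℤ
    ; R+   = R+
    ; R*   = R*
    ; R-   = R-
    ; Ra   = R* (R-ι a) Rz
    ; unit = λ {x} Rx → let y , eq , Ry = unit-a (R* Rz Rx) in
        y , trans (cong (λ r → y * (1ℚ + r)) (*-assoc (ι a) z x)) eq , Ry
    }

-- Otherwise a n = -1, and a is a unit of ℤ.
∣a∣≢1⇒1+a*n≢0 : ∀ a → ℤ.∣ a ∣ ≢ 1 → ∀ n → 1ℤ ℤ.+ a ℤ.* n ≢ 0ℤ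
∣a∣≢1⇒1+a*n≢0 a ∣a∣≢1 n eq = ∣a∣≢1 (ℕ.m*n≡1⇒m≡1 ℤ.∣ a ∣ ℤ.∣ n ∣ (begin
  ℤ.∣ a ∣ ℕ.* ℤ.∣ n ∣        ≡⟨ sym (ℤ.abs-* a n) ⟩
  ℤ.∣ a ℤ.* n ∣              ≡⟨ cong ℤ.∣_∣ (identity (a ℤ.* n)) ⟩
  ℤ.∣ 1ℤ ℤ.+ a ℤ.* n ℤ.- 1ℤ ∣  ≡⟨ cong (λ z → ℤ.∣ z ℤ.- 1ℤ ∣) eq ⟩
  1                          ∎))
  where
  identity : ∀ z → z ≡ 1ℤ ℤ.+ z ℤ.- 1ℤ
  identity = ℤ-Ring.solve-∀

unsign : ∀ a → ∃ λ s → a ℤ.* s ≡ ℤ.+ ℤ.∣ a ∣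
unsign (ℤ.+ n)    = 1ℤ , ℤ.*-identityʳ (ℤ.+ n)
unsign -[1+ n ] = ℤ.-1ℤ , cong ℤ.+_ (ℕ.*-identityʳ (suc n))

-- This exhibits 1/b as m / (1 + a n). The cases are the two signs of the Bézout identity over ℕ,
-- and `unsign` passes from ∣a∣ to a.
bézout : ∀ a b → C.Coprime ℤ.∣ a ∣ b → ∃₂ λ m n → ℤ.+ b ℤ.* m ≡ 1ℤ ℤ.+ a ℤ.* n
bézout a b coprime with unsign a | C.coprime-Bézout coprime
... | s , a*s | Bézout.+- x y eq = ℤ.- (ℤ.+ y) , s ℤ.* (ℤ.- (ℤ.+ x)) , (begin
    ℤ.+ b ℤ.* (ℤ.- (ℤ.+ y))                  ≡⟨ identity (ℤ.+ b) (ℤ.+ y) ⟩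
    1ℤ ℤ.- (1ℤ ℤ.+ ℤ.+ y ℤ.* ℤ.+ b)          ≡⟨ cong (λ z → 1ℤ ℤ.- z) y*b ⟩
    1ℤ ℤ.- ℤ.+ x ℤ.* ℤ.+ ℤ.∣ a ∣             ≡⟨ cong (λ z → 1ℤ ℤ.- ℤ.+ x ℤ.* z) (sym a*s) ⟩
    1ℤ ℤ.- ℤ.+ x ℤ.* (a ℤ.* s)             ≡⟨ identity′ (ℤ.+ x) a s ⟩
    1ℤ ℤ.+ a ℤ.* (s ℤ.* (ℤ.- (ℤ.+ x)))     ∎)
  where
  y*b : 1ℤ ℤ.+ ℤ.+ y ℤ.* ℤ.+ b ≡ ℤ.+ x ℤ.* ℤ.+ ℤ.∣ a ∣
  y*b = trans (cong (λ z → 1ℤ ℤ.+ z) (sym (ℤ.pos-* y b))) (trans (cong ℤ.+_ eq) (ℤ.pos-* x ℤ.∣ a ∣))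
  identity : ∀ b y → b ℤ.* (ℤ.- y) ≡ 1ℤ ℤ.- (1ℤ ℤ.+ y ℤ.* b)
  identity = ℤ-Ring.solve-∀
  identity′ : ∀ x a s → 1ℤ ℤ.- x ℤ.* (a ℤ.* s) ≡ 1ℤ ℤ.+ a ℤ.* (s ℤ.* (ℤ.- x))
  identity′ = ℤ-Ring.solve-∀
... | s , a*s | Bézout.-+ x y eq = ℤ.+ y , s ℤ.* ℤ.+ x , (begin
    ℤ.+ b ℤ.* ℤ.+ y                    ≡⟨ ℤ.*-comm (ℤ.+ b) (ℤ.+ y) ⟩
    ℤ.+ y ℤ.* ℤ.+ b                    ≡⟨ sym x*a ⟩
    1ℤ ℤ.+ ℤ.+ x ℤ.* ℤ.+ ℤ.∣ a ∣       ≡⟨ cong (λ z → 1ℤ ℤ.+ ℤ.+ x ℤ.* z) (sym a*s) ⟩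
    1ℤ ℤ.+ ℤ.+ x ℤ.* (a ℤ.* s)       ≡⟨ identity (ℤ.+ x) a s ⟩
    1ℤ ℤ.+ a ℤ.* (s ℤ.* ℤ.+ x)       ∎)
  where
  x*a : 1ℤ ℤ.+ ℤ.+ x ℤ.* ℤ.+ ℤ.∣ a ∣ ≡ ℤ.+ y ℤ.* ℤ.+ b
  x*a = trans (cong (λ z → 1ℤ ℤ.+ z) (sym (ℤ.pos-* x ℤ.∣ a ∣))) (trans (cong ℤ.+_ eq) (ℤ.pos-* y b))
  identity : ∀ x a s → 1ℤ ℤ.+ x ℤ.* (a ℤ.* s) ≡ 1ℤ ℤ.+ a ℤ.* (s ℤ.* x)
  identity = ℤ-Ring.solve-∀

ι-÷ : ∀ a d .(coprime : C.Coprime ℤ.∣ a ∣ (suc d)) → ι a * 1/ ι (ℤ.+ suc d) ≡ mkℚ a d coprime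
ι-÷ a d coprime = trans (cong₂ (λ x y → x / suc y) (ℤ.*-identityʳ a) (ℕ.+-identityʳ d))
                        (↥p/↧p≡p (mkℚ a d coprime))

localRing : ∀ u → ℤ.∣ ↥ u ∣ ≢ 1 → ∃ λ R → IsLocal u R
localRing (mkℚ a d coprime) ∣a∣≢1 = R , subst (λ x → IsLocal x R) (ι-÷ a d coprime) (isLocal Rz)
  where
  open Localization a (∣a∣≢1⇒1+a*n≢0 a ∣a∣≢1)
  b : ℚ
  b = ι (ℤ.+ suc d)
  Rz : R (1/ b)
  -- The coprimality stored in a rational is irrelevant, so it is recomputed before use.
  Rz with bézout a (suc d) (C.recompute coprime)
  ... | m , n , eq = frac m n (begin
    1/ b * ι (den n)              ≡⟨ cong (λ z → 1/ b * ι z) (sym eq) ⟩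
    1/ b * ι (ℤ.+ suc d ℤ.* m)      ≡⟨ cong (1/ b *_) (sym (ι-* (ℤ.+ suc d) m)) ⟩
    1/ b * (b * ι m)              ≡⟨ sym (*-assoc (1/ b) b (ι m)) ⟩
    1/ b * b * ι m                ≡⟨ cong (_* ι m) (*-inverseˡ b) ⟩
    1ℚ * ι m                      ≡⟨ solve 1 (λ x → con 1ℚ :* x := x) refl (ι m) ⟩
    ι m                           ∎)

-- Binary recursion for the coefficients of the product.

dbl≡+ : ∀ n → dbl n ≡ n ℕ.+ n
dbl≡+ zero    = refl
dbl≡+ (suc n) = cong suc (trans (cong suc (dbl≡+ n)) (sym (ℕ.+-suc n n)))

2^suc≡dbl : ∀ N → 2 ℕ.^ suc N ≡ dbl (2 ℕ.^ N)
2^suc≡dbl N = trans (cong (2 ℕ.^ N ℕ.+_) (ℕ.+-identityʳ (2 ℕ.^ N))) (sym (dbl≡+ (2 ℕ.^ N)))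

dbl-+ : ∀ m n → dbl m ℕ.+ dbl n ≡ dbl (m ℕ.+ n)
dbl-+ zero    n = refl
dbl-+ (suc m) n = cong (λ i → suc (suc i)) (dbl-+ m n)

dbl-mono : ∀ {m n} → m ℕ.≤ n → dbl m ℕ.≤ dbl n
dbl-mono z≤n     = z≤n
dbl-mono (s≤s p) = s≤s (s≤s (dbl-mono p))

dbl-cancel : ∀ m n → dbl m ℕ.≤ suc (dbl n) → m ℕ.≤ n
dbl-cancel zero    n       _             = z≤n
dbl-cancel (suc m) (suc n) (s≤s (s≤s p)) = s≤s (dbl-cancel m n p)
dbl-cancel (suc m) zero    (s≤s ())

dbl-∸ : ∀ n m → dbl n ∸ dbl m ≡ dbl (n ∸ m)
dbl-∸ n       zero    = refl
dbl-∸ zero    (suc m) = refl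
dbl-∸ (suc n) (suc m) = dbl-∸ n m

sucdbl-∸ : ∀ {n m} → m ℕ.≤ n → suc (dbl n) ∸ dbl m ≡ suc (dbl (n ∸ m))
sucdbl-∸ z≤n     = refl
sucdbl-∸ (s≤s p) = sucdbl-∸ p

n<2^n : ∀ n → n ℕ.< 2 ℕ.^ n
n<2^n zero    = s≤s z≤n
n<2^n (suc n) = ℕ.≤-trans (ℕ.+-mono-≤ (ℕ.m^n>0 2 n) (n<2^n n))
                          (ℕ.+-monoʳ-≤ (2 ℕ.^ n) (ℕ.m≤m+n (2 ℕ.^ n) 0))

module Coefficients (u : ℚ) where

  prod-≥ : ∀ N n → 2 ℕ.^ N ℕ.≤ n →
           prodCoeff u (suc N) n ≡ prodCoeff u N n + u * prodCoeff u N (n ∸ 2 ℕ.^ N)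
  prod-≥ N n p with 2 ℕ.^ N ℕ.≤? n
  ... | yes _  = refl
  ... | no  ¬p = contradiction p ¬p

  prod-< : ∀ N n → ¬ (2 ℕ.^ N ℕ.≤ n) → prodCoeff u (suc N) n ≡ prodCoeff u N n
  prod-< N n ¬p with 2 ℕ.^ N ℕ.≤? n
  ... | yes p = contradiction p ¬p
  ... | no  _ = refl

  -- ∏_{i≤N} (1 + u x^(2^i)) = (1 + u x) · (∏_{i<N} (1 + u x^(2^i)))(x²), coefficientwise.
  prod-even : ∀ N n → prodCoeff u (suc N) (dbl n) ≡ prodCoeff u N n
  prod-even zero zero    = refl
  prod-even zero (suc n) = solve 1 (λ u → con 0ℚ :+ u :* con 0ℚ := con 0ℚ) refl u
  prod-even (suc N) n with 2 ℕ.^ N ℕ.≤? n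
  ... | yes p = begin
    prodCoeff u (suc (suc N)) (dbl n)
      ≡⟨ prod-≥ (suc N) (dbl n) (subst (ℕ._≤ dbl n) (sym (2^suc≡dbl N)) (dbl-mono p)) ⟩
    prodCoeff u (suc N) (dbl n) + u * prodCoeff u (suc N) (dbl n ∸ 2 ℕ.^ suc N)
      ≡⟨ cong (λ i → prodCoeff u (suc N) (dbl n) + u * prodCoeff u (suc N) i)
           (trans (cong (dbl n ∸_) (2^suc≡dbl N)) (dbl-∸ n (2 ℕ.^ N))) ⟩
    prodCoeff u (suc N) (dbl n) + u * prodCoeff u (suc N) (dbl (n ∸ 2 ℕ.^ N))
      ≡⟨ cong₂ (λ x y → x + u * y) (prod-even N n) (prod-even N (n ∸ 2 ℕ.^ N)) ⟩
    prodCoeff u N n + u * prodCoeff u N (n ∸ 2 ℕ.^ N) ∎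
  ... | no ¬p = trans
    (prod-< (suc N) (dbl n) λ q → ¬p (dbl-cancel (2 ℕ.^ N) n
       (ℕ.m≤n⇒m≤1+n (subst (ℕ._≤ dbl n) (2^suc≡dbl N) q))))
    (prod-even N n)

  prod-odd : ∀ N n → prodCoeff u (suc N) (suc (dbl n)) ≡ u * prodCoeff u N n
  prod-odd zero zero    = +-identityˡ (u * 1ℚ)
  prod-odd zero (suc n) = +-identityˡ (u * 0ℚ)
  prod-odd (suc N) n with 2 ℕ.^ N ℕ.≤? n
  ... | yes p = begin
    prodCoeff u (suc (suc N)) (suc (dbl n))
      ≡⟨ prod-≥ (suc N) (suc (dbl n)) (subst (ℕ._≤ suc (dbl n)) (sym (2^suc≡dbl N)) (ℕ.m≤n⇒m≤1+n (dbl-mono p))) ⟩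
    prodCoeff u (suc N) (suc (dbl n)) + u * prodCoeff u (suc N) (suc (dbl n) ∸ 2 ℕ.^ suc N)
      ≡⟨ cong (λ i → prodCoeff u (suc N) (suc (dbl n)) + u * prodCoeff u (suc N) i)
           (trans (cong (suc (dbl n) ∸_) (2^suc≡dbl N)) (sucdbl-∸ p)) ⟩
    prodCoeff u (suc N) (suc (dbl n)) + u * prodCoeff u (suc N) (suc (dbl (n ∸ 2 ℕ.^ N)))
      ≡⟨ cong₂ (λ x y → x + u * y) (prod-odd N n) (prod-odd N (n ∸ 2 ℕ.^ N)) ⟩
    u * prodCoeff u N n + u * (u * prodCoeff u N (n ∸ 2 ℕ.^ N))
      ≡⟨ solve 3 (λ u x y → u :* x :+ u :* (u :* y) := u :* (x :+ u :* y)) refl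
           u (prodCoeff u N n) (prodCoeff u N (n ∸ 2 ℕ.^ N)) ⟩
    u * (prodCoeff u N n + u * prodCoeff u N (n ∸ 2 ℕ.^ N)) ∎
  ... | no ¬p = trans
    (prod-< (suc N) (suc (dbl n)) λ q → ¬p (dbl-cancel (2 ℕ.^ N) n
       (subst (ℕ._≤ suc (dbl n)) (2^suc≡dbl N) q)))
    (prod-odd N n)

  -- Because n < 2^n, the factors from the n-th on do not reach degree n.
  prod-stable : ∀ j n → prodCoeff u (j ℕ.+ n) n ≡ prodCoeff u n n
  prod-stable zero    n = refl
  prod-stable (suc j) n = trans
    (prod-< (j ℕ.+ n) n (ℕ.<⇒≱ (ℕ.<-≤-trans (n<2^n n) (ℕ.^-monoʳ-≤ 2 (ℕ.m≤n+m n j)))))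
    (prod-stable j n)

  w : ℕ → ℚ
  w = infProdCoeff u

  prod-w : ∀ j n → prodCoeff u (j ℕ.+ n) n ≡ w n
  prod-w j n = trans (prod-stable j n) (sym (prod-stable 1 n))

  w-even : ∀ n → w (dbl n) ≡ w n
  w-even n = trans (prod-even (dbl n) n)
    (trans (cong (λ N → prodCoeff u N n) (dbl≡+ n)) (prod-w n n))

  w-odd : ∀ n → w (suc (dbl n)) ≡ u * w n
  w-odd n = trans (prod-odd (suc (dbl n)) n)
    (cong (u *_) (trans (cong (λ N → prodCoeff u (suc N) n) (dbl≡+ n)) (prod-w (suc n) n)))

  w≢0 : u ≢ 0ℚ → ∀ n → w n ≢ 0ℚ
  w≢0 u≢0 = <-rec (λ n → w n ≢ 0ℚ) step
    where
    step : ∀ n → (∀ {m} → m ℕ.< n → w m ≢ 0ℚ) → w n ≢ 0ℚ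
    step n rec eq with parity n
    ... | even zero    = contradiction eq λ ()
    ... | even (suc k) = rec (s≤s (s≤s (dbl-≥ k))) (trans (sym (w-even (suc k))) eq)
    ... | odd  k       = rec (s≤s (dbl-≥ k))
      (*≡0⇒≡0 (w k) u (trans (*-comm (w k) u) (trans (sym (w-odd k)) eq)) u≢0)

-- Reversal of a window, exchanging u and 1/u.

Vanish-lookup : ∀ {f} k n → Vanish f k n → ∀ i → i ℕ.< n → f (i ℕ.+ k) ≡ 0ℚ
Vanish-lookup k (suc n) (p , _) zero    _       = p
Vanish-lookup {f} k (suc n) (_ , r) (suc i) (s≤s q) =
  trans (cong f (sym (ℕ.+-suc i k))) (Vanish-lookup (suc k) n r i q)

Vanish-tabulate : ∀ {f} k n → (∀ i → i ℕ.< n → f (i ℕ.+ k) ≡ 0ℚ) → Vanish f k n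
Vanish-tabulate     k zero    h = tt
Vanish-tabulate {f} k (suc n) h = h 0 (s≤s z≤n) ,
  Vanish-tabulate (suc k) n λ i q → trans (cong f (ℕ.+-suc i k)) (h (suc i) (s≤s q))

Null-unsnoc : ∀ (X : Vec ℚ n) {c} → Null (X ∷ʳ c) → Null X × c ≡ 0ℚ
Null-unsnoc []      (c ∷ []) = [] , c
Null-unsnoc (x ∷ X) (p ∷ N)  = let N′ , c = Null-unsnoc X N in p ∷ N′ , c

Null-reverse : (X : Vec ℚ n) → Null (reverse X) → Null X
Null-reverse []      _ = []
Null-reverse (x ∷ X) N = let N′ , c = Null-unsnoc (reverse X) (subst Null (reverse-∷ x X) N)
                         in c ∷ Null-reverse X N′

dbl-injective : ∀ {m n} → dbl m ≡ dbl n → m ≡ n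
dbl-injective {zero}  {zero}  _  = refl
dbl-injective {suc m} {suc n} eq = cong suc (dbl-injective (ℕ.suc-injective (ℕ.suc-injective eq)))

dbl≢sucdbl : ∀ m n → dbl m ≢ suc (dbl n)
dbl≢sucdbl (suc m) (suc n) eq = dbl≢sucdbl m n (ℕ.suc-injective (ℕ.suc-injective eq))
dbl≢sucdbl (suc zero) zero ()

module Reflection (u v : ℚ) (vu≡1 : v * u ≡ 1ℚ) (x z : ℕ → ℚ)
  (x-0 : x 0 ≡ 1ℚ) (z-0 : z 0 ≡ 1ℚ)
  (x-even : ∀ n → x (dbl n) ≡ x n) (x-odd : ∀ n → x (suc (dbl n)) ≡ u * x n)
  (z-even : ∀ n → z (dbl n) ≡ z n) (z-odd : ∀ n → z (suc (dbl n)) ≡ v * z n) where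

  u*v* : ∀ r → u * (v * r) ≡ r
  u*v* r = trans (solve 3 (λ u v r → u :* (v :* r) := v :* u :* r) refl u v r)
                 (trans (cong (_* r) vu≡1) (*-identityˡ r))

  -- Indices with sum 2^M - 1 have complementary binary digits, so their digit sums add up to M.
  reflect : ∀ M m m′ → suc (m ℕ.+ m′) ≡ 2 ℕ.^ M → x m ≡ u ^ M * z m′
  reflect zero zero zero refl = trans x-0 (sym (trans (*-identityˡ (z 0)) z-0))
  reflect zero zero (suc m′) ()
  reflect zero (suc m) m′ ()
  reflect (suc M) m m′ eq with parity m | parity m′
  -- The sum 2^(M+1) - 1 is odd, so m and m′ have different parities.
  ... | even a | even b = contradiction (trans (sym (2^suc≡dbl M)) (trans (sym eq) (cong suc (dbl-+ a b))))
                            (dbl≢sucdbl (2 ℕ.^ M) (a ℕ.+ b))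
  ... | odd a | odd b = contradiction
        (trans (sym (2^suc≡dbl M)) (trans (sym eq) (cong suc (trans (cong suc (ℕ.+-suc (dbl a) (dbl b)))
          (cong (λ i → suc (suc i)) (dbl-+ a b))))))
        (dbl≢sucdbl (2 ℕ.^ M) (suc (a ℕ.+ b)))
  ... | even a | odd b = begin
    x (dbl a)                 ≡⟨ x-even a ⟩
    x a                       ≡⟨ reflect M a b a+b ⟩
    u ^ M * z b               ≡⟨ cong (u ^ M *_) (sym (u*v* (z b))) ⟩
    u ^ M * (u * (v * z b))   ≡⟨ solve 3 (λ p u r → p :* (u :* r) := u :* p :* r) refl (u ^ M) u (v * z b) ⟩
    u ^ suc M * (v * z b)     ≡⟨ cong (u ^ suc M *_) (sym (z-odd b)) ⟩
    u ^ suc M * z (suc (dbl b)) ∎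
    where
    a+b : suc (a ℕ.+ b) ≡ 2 ℕ.^ M
    a+b = dbl-injective (trans (cong (λ i → suc (suc i)) (sym (dbl-+ a b)))
            (trans (cong suc (sym (ℕ.+-suc (dbl a) (dbl b)))) (trans eq (2^suc≡dbl M))))
  ... | odd a | even b = begin
    x (suc (dbl a))           ≡⟨ x-odd a ⟩
    u * x a                   ≡⟨ cong (u *_) (reflect M a b a+b) ⟩
    u * (u ^ M * z b)         ≡⟨ sym (*-assoc u (u ^ M) (z b)) ⟩
    u ^ suc M * z b           ≡⟨ cong (u ^ suc M *_) (sym (z-even b)) ⟩
    u ^ suc M * z (dbl b)     ∎
    where
    a+b : suc (a ℕ.+ b) ≡ 2 ℕ.^ M
    a+b = dbl-injective (trans (cong (λ i → suc (suc i)) (sym (dbl-+ a b))) (trans eq (2^suc≡dbl M)))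

  -- Index m + i is complementary to m′ + (n - 1 - i): the coefficients appear in reverse order, and
  -- u^M factors out.
  pair-reflect : ∀ M (q : Vec ℚ n) m m′ → m ℕ.+ m′ ℕ.+ n ≡ 2 ℕ.^ M →
                 pair x q m ≡ u ^ M * pair z (reverse q) m′
  pair-reflect M [] m m′ eq = sym (*-zeroʳ (u ^ M))
  pair-reflect {suc n} M (c ∷ q) m m′ eq = begin
    c * x m + pair x q (suc m)
      ≡⟨ cong₂ (λ r s → c * r + s)
           (reflect M m (n ℕ.+ m′) (trans (index₁ m m′ n) eq))
           (pair-reflect M q (suc m) m′ (trans (index₂ m m′ n) eq)) ⟩
    c * (u ^ M * z (n ℕ.+ m′)) + u ^ M * pair z (reverse q) m′
      ≡⟨ solve 4 (λ c p r s → c :* (p :* r) :+ p :* s := p :* (s :+ c :* r)) refl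
           c (u ^ M) (z (n ℕ.+ m′)) (pair z (reverse q) m′) ⟩
    u ^ M * (pair z (reverse q) m′ + c * z (n ℕ.+ m′))
      ≡⟨ cong (u ^ M *_) (sym (pair-∷ʳ z (reverse q) c m′)) ⟩
    u ^ M * pair z (reverse q ∷ʳ c) m′
      ≡⟨ cong (λ X → u ^ M * pair z X m′) (sym (reverse-∷ c q)) ⟩
    u ^ M * pair z (reverse (c ∷ q)) m′ ∎
    where
    index₁ : ∀ m m′ n → suc (m ℕ.+ (n ℕ.+ m′)) ≡ m ℕ.+ m′ ℕ.+ suc n
    index₁ = ℕ-Ring.solve-∀
    index₂ : ∀ m m′ n → suc m ℕ.+ m′ ℕ.+ n ≡ m ℕ.+ m′ ℕ.+ suc n
    index₂ = ℕ-Ring.solve-∀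

  u^≢0 : ∀ M → u ^ M ≢ 0ℚ
  u^≢0 zero    ()
  u^≢0 (suc M) eq = u^≢0 M (*≡0⇒≡0 (u ^ M) u (trans (*-comm (u ^ M) u) eq) (invertible⇒≢0 u v vu≡1))

  nondeg-reflect : ∀ n → (∀ k (q : Vec ℚ n) → Vanish (pair z q) k n → Null q) →
                   ∀ k (q : Vec ℚ n) → Vanish (pair x q) k n → Null q
  nondeg-reflect n nd k q van = Null-reverse q
    (nd K (reverse q) (Vanish-tabulate K n λ i i<n → vanish i (n ∸ suc i) (ℕ.m∸n+n≡m i<n)))
    where
    -- The pairings involve indices below k + 2n, and this M satisfies M < 2^M, so they fit into the
    -- window. The reversed run then starts at K = 2^M - (k + 2n) + 1.
    M = k ℕ.+ n ℕ.+ n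
    K = suc (2 ℕ.^ M ∸ M)
    vanish : ∀ i j → j ℕ.+ suc i ≡ n → pair z (reverse q) (i ℕ.+ K) ≡ 0ℚ
    vanish i j eq = *≡0⇒≡0 _ (u ^ M) (begin
      pair z (reverse q) (i ℕ.+ K) * u ^ M ≡⟨ *-comm _ (u ^ M) ⟩
      u ^ M * pair z (reverse q) (i ℕ.+ K) ≡⟨ sym (pair-reflect M q (j ℕ.+ k) (i ℕ.+ K) index) ⟩
      pair x q (j ℕ.+ k) ≡⟨ Vanish-lookup k n van j (subst (j ℕ.<_) eq (ℕ.m<m+n j (s≤s z≤n))) ⟩
      0ℚ ∎) (u^≢0 M)
      where
      rearrange : ∀ i j k n e → j ℕ.+ k ℕ.+ (i ℕ.+ suc e) ℕ.+ n ≡ e ℕ.+ (k ℕ.+ (j ℕ.+ suc i) ℕ.+ n)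
      rearrange = ℕ-Ring.solve-∀
      index : j ℕ.+ k ℕ.+ (i ℕ.+ K) ℕ.+ n ≡ 2 ℕ.^ M
      index = trans (rearrange i j k n (2 ℕ.^ M ∸ M))
                (trans (cong (λ l → 2 ℕ.^ M ∸ M ℕ.+ (k ℕ.+ l ℕ.+ n)) eq)
                       (ℕ.m∸n+n≡m (ℕ.<⇒≤ (n<2^n M))))

-- If the numerator of u is ±1 then that of 1/u is not, and n ↦ 2^M − 1 − n exchanges u and 1/u.
nondegenerate : ∀ u → u ≢ - 1ℚ → u ≢ 0ℚ → u ≢ 1ℚ →
                ∀ n k (q : Vec ℚ n) → Vanish (pair (infProdCoeff u) q) k n → Null q
nondegenerate u u≢-1 u≢0 u≢1 n with ℤ.∣ ↥ u ∣ ℕ.≟ 1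
... | no ∣a∣≢1 = Approximants.nondegenerate u (1/ u) (*-inverseˡ u) w w-even w-odd (w≢0 u≢0)
                   (proj₂ (localRing u ∣a∣≢1)) n
  where open Coefficients u
        instance _ = ≢-nonZero u≢0
... | yes ∣a∣≡1 = Reflection.nondeg-reflect u v vu≡1 (infProdCoeff u) (infProdCoeff v) (refl-0 u) (refl-0 v)
                    (Coefficients.w-even u) (Coefficients.w-odd u) w-even w-odd n
                    (Approximants.nondegenerate v u (trans (*-comm u v) vu≡1) w w-even w-odd (w≢0 v≢0)
                      (proj₂ (localRing v (numerator≢1 u u≢1 u≢-1 ∣a∣≡1))) n)
  where
  instance _ = ≢-nonZero u≢0
  v = 1/ u
  open Coefficients v
  vu≡1 : v * u ≡ 1ℚ
  vu≡1 = *-inverseˡ u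
  v≢0 : v ≢ 0ℚ
  v≢0 = invertible⇒≢0 v u (trans (*-comm u v) vu≡1)
  refl-0 : ∀ u → infProdCoeff u 0 ≡ 1ℚ
  refl-0 u = refl
  -- With denominator 1, u would be ±1; otherwise the denominator, at least 2, becomes the absolute
  -- value of the numerator of 1/u.
  numerator≢1 : ∀ u → u ≢ 1ℚ → u ≢ - 1ℚ → ℤ.∣ ↥ u ∣ ≡ 1 →
                ∀ .{{_ : NonZero u}} → ℤ.∣ ↥ (1/ u) ∣ ≢ 1
  numerator≢1 (mkℚ +[1+ 0 ] zero _)    u≢1 u≢-1 refl _  = u≢1 refl
  numerator≢1 (mkℚ -[1+ 0 ] zero _)    u≢1 u≢-1 refl _  = u≢-1 refl
  numerator≢1 (mkℚ +[1+ 0 ] (suc d) _) u≢1 u≢-1 refl ()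
  numerator≢1 (mkℚ -[1+ 0 ] (suc d) _) u≢1 u≢-1 refl ()

-- Pairings with X(t²), (t + 1) X(t²) and quotients by s - 1.

pair-cong : ∀ {f g} → (∀ j → f j ≡ g j) → (q : Vec ℚ n) → ∀ m → pair f q m ≡ pair g q m
pair-cong f≗g []      m = refl
pair-cong f≗g (c ∷ q) m = cong₂ (λ x y → c * x + y) (f≗g m) (pair-cong f≗g q (suc m))

pair-shift : ∀ f (q : Vec ℚ n) m → pair f q (suc m) ≡ pair (λ j → f (suc j)) q m
pair-shift f []      m = refl
pair-shift f (c ∷ q) m = cong (c * f (suc m) +_) (pair-shift f q (suc m))

pair-linear : ∀ α β f g (q : Vec ℚ n) m →
              pair (λ j → α * f j + β * g j) q m ≡ α * pair f q m + β * pair g q m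
pair-linear α β f g []      m =
  solve 2 (λ a b → con 0ℚ := a :* con 0ℚ :+ b :* con 0ℚ) refl α β
pair-linear α β f g (c ∷ q) m =
  trans (cong (c * (α * f m + β * g m) +_) (pair-linear α β f g q (suc m)))
        (solve 7 (λ a b c x y p r → c :* (a :* x :+ b :* y) :+ (a :* p :+ b :* r)
           := a :* (c :* x :+ p) :+ b :* (c :* y :+ r)) refl
           α β c (f m) (g m) (pair f q (suc m)) (pair g q (suc m)))

-- The polynomial X(t²); no zero follows its last coefficient, so that the formal degree exactly
-- doubles.
spread : Vec ℚ (suc n) → Vec ℚ (suc (dbl n))
spread (x ∷ [])         = x ∷ []
spread (x ∷ X@(_ ∷ _))  = x ∷ 0ℚ ∷ spread X

pair-spread : ∀ f (X : Vec ℚ (suc n)) m → pair f (spread X) (dbl m) ≡ pair (λ j → f (dbl j)) X m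
pair-spread f (x ∷ [])        m = refl
pair-spread f (x ∷ X@(_ ∷ _)) m = cong (x * f (dbl m) +_)
  (trans (cong (0ℚ * f (suc (dbl m)) +_) (pair-spread f X (suc m)))
         (solve 2 (λ z p → con 0ℚ :* z :+ p := p) refl (f (suc (dbl m))) (pair (λ j → f (dbl j)) X (suc m))))

-- The polynomial (t + 1) X(t²).
dup : Vec ℚ n → Vec ℚ (dbl n)
dup []      = []
dup (x ∷ X) = x ∷ x ∷ dup X

pair-dup : ∀ f (X : Vec ℚ n) m →
           pair f (dup X) (dbl m) ≡ pair (λ j → f (dbl j) + f (suc (dbl j))) X m
pair-dup f []      m = refl
pair-dup f (x ∷ X) m =
  trans (cong (λ p → x * f (dbl m) + (x * f (suc (dbl m)) + p)) (pair-dup f X (suc m)))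
        (solve 4 (λ x a b p → x :* a :+ (x :* b :+ p) := x :* (a :+ b) :+ p) refl
           x (f (dbl m)) (f (suc (dbl m))) (pair (λ j → f (dbl j) + f (suc (dbl j))) X (suc m)))

one : ℕ → ℚ
one _ = 1ℚ

-- The quotient of A − h by s − 1, where h = A(1).
quot : ℚ → Vec ℚ (suc n) → Vec ℚ n
quot h (a ∷ [])        = []
quot h (a ∷ A@(_ ∷ _)) = h - a ∷ quot (h - a) A

-- Here A = h + (s - 1) `quot h A`, and the factor s - 1 becomes a difference of `f` in the pairing.
pair-quot : ∀ f h (A : Vec ℚ (suc n)) m → pair one A m ≡ h →
            pair f A m ≡ h * f m + pair (λ j → f (suc j) - f j) (quot h A) m
pair-quot f h (a ∷ []) m eq = cong (λ x → x * f m + 0ℚ)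
  (trans (solve 1 (λ a → a := a :* con 1ℚ :+ con 0ℚ) refl a) eq)
pair-quot f h (a ∷ A@(_ ∷ _)) m eq = begin
  a * f m + pair f A (suc m)
    ≡⟨ cong (a * f m +_) (pair-quot f (h - a) A (suc m) (begin
         pair one A (suc m)                    ≡⟨ solve 2 (λ a p → p := a :* con 1ℚ :+ p :- a) refl a (pair one A (suc m)) ⟩
         a * 1ℚ + pair one A (suc m) - a       ≡⟨ cong (_- a) eq ⟩
         h - a                                 ∎)) ⟩
  a * f m + ((h - a) * f (suc m) + p)
    ≡⟨ solve 5 (λ a h x y p → a :* x :+ ((h :- a) :* y :+ p) := h :* x :+ ((h :- a) :* (y :- x) :+ p))
         refl a h (f m) (f (suc m)) p ⟩
  h * f m + ((h - a) * (f (suc m) - f m) + p) ∎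
  where p = pair (λ j → f (suc j) - f j) (quot (h - a) A) (suc m)

Vanish-prefix : ∀ {f} k n → Vanish f k (suc n) → Vanish f k n
Vanish-prefix k zero    _       = tt
Vanish-prefix k (suc n) (p , r) = p , Vanish-prefix (suc k) n r

⌊dbl/2⌋ : ∀ e → ⌊ dbl e /2⌋ ≡ e
⌊dbl/2⌋ zero    = refl
⌊dbl/2⌋ (suc e) = cong suc (⌊dbl/2⌋ e)

⌊sucdbl/2⌋ : ∀ e → ⌊ suc (dbl e) /2⌋ ≡ e
⌊sucdbl/2⌋ zero    = refl
⌊sucdbl/2⌋ (suc e) = cong suc (⌊sucdbl/2⌋ e)

two : ℚ
two = ι (ℤ.+ 2)

nat : ℕ → ℚ
nat j = ι (ℤ.+ j)

nat-suc : ∀ j → nat (suc j) ≡ 1ℚ + nat j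
nat-suc j = sym (ι-+ 1ℤ (ℤ.+ j))

nat-dbl : ∀ j → nat (dbl j) ≡ two * nat j
nat-dbl j = begin
  nat (dbl j)      ≡⟨ cong nat (dbl≡+ j) ⟩
  nat (j ℕ.+ j)    ≡⟨ sym (ι-+ (ℤ.+ j) (ℤ.+ j)) ⟩
  nat j + nat j    ≡⟨ solve 1 (λ x → x :+ x := con two :* x) refl (nat j) ⟩
  two * nat j      ∎

-- Convergents of the Thue-Morse series (u = -1, k = 0), 2-adically.

module ThueMorse where
  -- The denominators 1 + 2n are the odd numbers: R is ℤ localized at 2.
  open Localization (ℤ.+ 2) (∣a∣≢1⇒1+a*n≢0 (ℤ.+ 2) (λ ())) using (R; R+; R*; R-; R-ι; unit-a)
  open Coefficients (- 1ℚ) using (w; w-even; w-odd; w≢0)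
  -- As u² = 1, `Approx` now asks for Q(1) ≠ 0.
  open Digits (- 1ℚ) (- 1ℚ) refl w w-even w-odd (w≢0 (λ ()))

  R-pair : ∀ f → (∀ j → R (f j)) → {q : Vec ℚ n} → All R q → ∀ m → R (pair f q m)
  R-pair f Rf []        m = R-ι 0ℤ
  R-pair f Rf (Rc ∷ Rq) m = R+ (R* Rc (Rf m)) (R-pair f Rf Rq (suc m))

  R-spread : (X : Vec ℚ (suc n)) → All R X → All R (spread X)
  R-spread (x ∷ [])        Rs       = Rs
  R-spread (x ∷ X@(_ ∷ _)) (r ∷ Rs) = r ∷ R-ι 0ℤ ∷ R-spread X Rs

  R-dup : {X : Vec ℚ n} → All R X → All R (dup X)
  R-dup []       = []
  R-dup (r ∷ Rs) = r ∷ r ∷ R-dup Rs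

  R-quot : ∀ {h} (A : Vec ℚ (suc n)) → R h → All R A → All R (quot h A)
  R-quot (a ∷ [])        Rh _        = []
  R-quot (a ∷ A@(_ ∷ _)) Rh (r ∷ Rs) = R+ Rh (R- r) ∷ R-quot A (R+ Rh (R- r)) Rs

  R-comb : ∀ {α β} {X Y : Vec ℚ n} → R α → R β → All R X → All R Y → All R (comb α β X Y)
  R-comb Rα Rβ []       []       = []
  R-comb Rα Rβ (x ∷ X) (y ∷ Y) = R+ (R* Rα x) (R* Rβ y) ∷ R-comb Rα Rβ X Y

  R-∷ʳ0 : {X : Vec ℚ n} → All R X → All R (X ∷ʳ 0ℚ)
  R-∷ʳ0 []       = R-ι 0ℤ ∷ []
  R-∷ʳ0 (r ∷ Rs) = r ∷ R-∷ʳ0 Rs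

  -- pair one Q 0 = Q(1) and pair nat Q 0 = Q′(1).
  record Good (n : ℕ) : Set where
    field
      Q      : Vec ℚ (suc n)
      RQ     : All R Q
      vanish : Vanish (pair w Q) 0 n
      z d    : ℚ
      Rz     : R z
      Rd     : R d
      value  : pair one Q 0 ≡ two * (1ℚ + two * z)
      deriv  : pair nat Q 0 ≡ nat n + two * d

  good-1 : Good 1
  good-1 = record
    { Q = 1ℚ ∷ 1ℚ ∷ []; RQ = R-ι 1ℤ ∷ R-ι 1ℤ ∷ []; vanish = refl , tt
    ; z = 0ℚ; d = 0ℚ; Rz = R-ι 0ℤ; Rd = R-ι 0ℤ; value = refl; deriv = refl }

  -- Substituting t² keeps the value at 1 and doubles the derivative there. At odd indices the
  -- pairing is the negative of the one at even indices.
  good-even : ∀ e → Good e → Good (dbl e)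
  good-even e G = record
    { Q      = spread Q
    ; RQ     = R-spread Q RQ
    ; vanish = zip-even 0 (dbl e) (subst (Vanish (pair w Q) 0) (sym (⌊sucdbl/2⌋ e)) vanish)
                 (subst (Vanish odds 0) (sym (⌊dbl/2⌋ e)) (Vanish-map (λ m p → cong ((- 1ℚ) *_) p) 0 e vanish))
    ; z      = z
    -- This is 2d, since the derivative becomes 2 (e + 2d) = 2e + 2 (2d).
    ; d      = nat e + two * d - nat e
    ; Rz     = Rz
    ; Rd     = R+ (R+ (R-ι (ℤ.+ e)) (R* (R-ι (ℤ.+ 2)) Rd)) (R- (R-ι (ℤ.+ e)))
    ; value  = trans (pair-spread one Q 0) value
    ; deriv  = begin
        pair nat (spread Q) 0                          ≡⟨ pair-spread nat Q 0 ⟩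
        pair (λ j → nat (dbl j)) Q 0                   ≡⟨ pair-cong (λ j → trans (nat-dbl j) (double (nat j))) Q 0 ⟩
        pair (λ j → two * nat j + 0ℚ * nat j) Q 0      ≡⟨ pair-linear two 0ℚ nat nat Q 0 ⟩
        two * pair nat Q 0 + 0ℚ * pair nat Q 0         ≡⟨ sym (double (pair nat Q 0)) ⟩
        two * pair nat Q 0                             ≡⟨ cong (two *_) deriv ⟩
        two * (nat e + two * d)                        ≡⟨ solve 2 (λ e d → con two :* (e :+ con two :* d)
                                                            := con two :* e :+ con two :* (e :+ con two :* d :- e))
                                                            refl (nat e) d ⟩
        two * nat e + two * (nat e + two * d - nat e)  ≡⟨ cong (_+ two * (nat e + two * d - nat e)) (sym (nat-dbl e)) ⟩
        nat (dbl e) + two * (nat e + two * d - nat e)  ∎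
    }
    where
    open Good G
    double : ∀ x → two * x ≡ two * x + 0ℚ * x
    double = solve 1 (λ x → con two :* x := con two :* x :+ con 0ℚ :* x) refl
    neg : ∀ x → (- 1ℚ) * x ≡ (- 1ℚ) * x + 0ℚ * x
    neg = solve 1 (λ x → con (- 1ℚ) :* x := con (- 1ℚ) :* x :+ con 0ℚ :* x) refl
    odds : ℕ → ℚ
    odds m = (- 1ℚ) * pair w Q m
    open Interleave (pair w (spread Q)) (pair w Q) odds
      (λ m → trans (pair-spread w Q m) (pair-cong w-even Q m))
      (λ m → begin
        pair w (spread Q) (suc (dbl m))             ≡⟨ pair-shift w (spread Q) (dbl m) ⟩
        pair (λ j → w (suc j)) (spread Q) (dbl m)   ≡⟨ pair-spread _ Q m ⟩
        pair (λ j → w (suc (dbl j))) Q m            ≡⟨ pair-cong (λ j → trans (w-odd j) (neg (w j))) Q m ⟩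
        pair (λ j → (- 1ℚ) * w j + 0ℚ * w j) Q m    ≡⟨ pair-linear (- 1ℚ) 0ℚ w w Q m ⟩
        (- 1ℚ) * pair w Q m + 0ℚ * pair w Q m       ≡⟨ sym (neg (pair w Q m)) ⟩
        (- 1ℚ) * pair w Q m                         ∎)

  -- As (s - 1) r = A, r(1) = A′(1) = Q′ₑ₊₁(1) - c Q′ₑ(1), which is odd because c is; this is what
  -- the derivatives are tracked for. Then Q = (t + 1) r(t²) has Q(1) = 2 r(1) and Q′(1) = r(1) + 4
  -- r′(1). Its pairing is 0 at even indices, as w(2j) + w(2j+1) = 0, and that of `A` at odd ones.
  good-odd : ∀ e → Good e → Good (suc e) → Good (suc (dbl e))
  good-odd e G G′ with unit-a (Good.Rz G)
  ... | y , y-inv , Ry = record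
    { Q      = dup r
    ; RQ     = R-dup Rr
    ; vanish = zip-even 0 (suc (dbl e)) (Vanish-const (λ _ → refl) 0 _)
                 (subst (Vanish (pair w A) 0) (sym (⌊sucdbl/2⌋ e)) vanish-A)
    ; z      = ρ
    ; d      = ρ + two * κ - nat e
    ; Rz     = Rρ
    ; Rd     = R+ (R+ Rρ (R* (R-ι (ℤ.+ 2)) Rκ)) (R- (R-ι (ℤ.+ e)))
    ; value  = begin
        pair one (dup r) 0                    ≡⟨ pair-dup one r 0 ⟩
        pair (λ _ → 1ℚ + 1ℚ) r 0              ≡⟨ pair-linear 1ℚ 1ℚ one one r 0 ⟩
        1ℚ * pair one r 0 + 1ℚ * pair one r 0 ≡⟨ solve 1 (λ x → con 1ℚ :* x :+ con 1ℚ :* x := con two :* x) refl (pair one r 0) ⟩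
        two * pair one r 0                    ≡⟨ cong (two *_) value-r ⟩
        two * (1ℚ + two * ρ)                  ∎
    ; deriv  = begin
        pair nat (dup r) 0                            ≡⟨ pair-dup nat r 0 ⟩
        pair (λ j → nat (dbl j) + nat (suc (dbl j))) r 0
          ≡⟨ pair-cong (λ j → trans (cong (nat (dbl j) +_) (nat-suc (dbl j))) (trans (cong (λ x → x + (1ℚ + x)) (nat-dbl j))
               (solve 1 (λ x → con two :* x :+ (con 1ℚ :+ con two :* x)
                  := con 1ℚ :* con 1ℚ :+ con (two * two) :* x) refl (nat j)))) r 0 ⟩
        pair (λ j → 1ℚ * one j + two * two * nat j) r 0 ≡⟨ pair-linear 1ℚ (two * two) one nat r 0 ⟩
        1ℚ * pair one r 0 + two * two * κ             ≡⟨ cong (λ x → 1ℚ * x + two * two * κ) value-r ⟩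
        1ℚ * (1ℚ + two * ρ) + two * two * κ
          ≡⟨ solve 3 (λ p k e → con 1ℚ :* (con 1ℚ :+ con two :* p) :+ con two :* con two :* k
               := con 1ℚ :+ con two :* e :+ con two :* (p :+ con two :* k :- e)) refl ρ κ (nat e) ⟩
        1ℚ + two * nat e + two * (ρ + two * κ - nat e)
          ≡⟨ cong (_+ two * (ρ + two * κ - nat e)) (sym (trans (nat-suc (dbl e)) (cong (1ℚ +_) (nat-dbl e)))) ⟩
        nat (suc (dbl e)) + two * (ρ + two * κ - nat e) ∎
    }
    where
    open Good G
    module G′ = Good G′

    -- c = 1 + 2c′ is the quotient of the values at 1, so that A(1) = 0.
    c′ c ρ : ℚ
    c′ = (G′.z - z) * y
    c  = 1ℚ + two * c′
    -- Chosen so that A′(1) = (e + 1 + 2 `G′.d`) - c (e + 2d) = 1 + 2ρ.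
    ρ  = G′.d - d - c′ * nat e - two * (c′ * d)

    Rc′ : R c′
    Rc′ = R* (R+ G′.Rz (R- Rz)) Ry

    Rρ : R ρ
    Rρ = R+ (R+ (R+ G′.Rd (R- Rd)) (R- (R* Rc′ (R-ι (ℤ.+ e))))) (R- (R* (R-ι (ℤ.+ 2)) (R* Rc′ Rd)))

    A : Vec ℚ (suc (suc e))
    A = comb 1ℚ (- c) G′.Q (Q ∷ʳ 0ℚ)

    pair-A : ∀ f m → pair f A m ≡ 1ℚ * pair f G′.Q m + (- c) * pair f Q m
    pair-A f m = trans (pair-comb f 1ℚ (- c) G′.Q (Q ∷ʳ 0ℚ) m)
                       (cong (λ x → 1ℚ * pair f G′.Q m + (- c) * x) (pair-∷ʳ0 f Q m))

    A[1]≡0 : pair one A 0 ≡ 0ℚ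
    A[1]≡0 = begin
      pair one A 0                                  ≡⟨ pair-A one 0 ⟩
      1ℚ * pair one G′.Q 0 + (- c) * pair one Q 0   ≡⟨ cong₂ (λ x x′ → 1ℚ * x + (- c) * x′) G′.value value ⟩
      1ℚ * (two * (1ℚ + two * G′.z)) + (- c) * (two * (1ℚ + two * z))
        ≡⟨ solve 3 (λ z z′ y → con 1ℚ :* (con two :* (con 1ℚ :+ con two :* z′))
             :+ (:- (con 1ℚ :+ con two :* ((z′ :- z) :* y))) :* (con two :* (con 1ℚ :+ con two :* z))
             := con two :* con two :* (z′ :- z) :* (con 1ℚ :- y :* (con 1ℚ :+ con two :* z))) refl z G′.z y ⟩
      two * two * (G′.z - z) * (1ℚ - y * (1ℚ + two * z))
        ≡⟨ cong (λ x → two * two * (G′.z - z) * (1ℚ - x)) y-inv ⟩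
      two * two * (G′.z - z) * (1ℚ - 1ℚ)            ≡⟨ *-zeroʳ (two * two * (G′.z - z)) ⟩
      0ℚ                                            ∎

    RA : All R A
    RA = R-comb (R-ι 1ℤ) (R- (R+ (R-ι 1ℤ) (R* (R-ι (ℤ.+ 2)) Rc′))) G′.RQ (R-∷ʳ0 RQ)

    vanish-A : Vanish (pair w A) 0 e
    vanish-A = Vanish-zip (λ m p q → trans (pair-A w m) (comb≡0 1ℚ (- c) p q)) 0 e
                 (Vanish-prefix 0 e G′.vanish) vanish

    r : Vec ℚ (suc e)
    r = quot 0ℚ A

    Rr : All R r
    Rr = R-quot A (R-ι 0ℤ) RA

    κ : ℚ
    κ = pair nat r 0

    Rκ : R κ
    Rκ = R-pair nat (λ j → R-ι (ℤ.+ j)) Rr 0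

    pair-r : ∀ f m → pair one A m ≡ 0ℚ → pair f A m ≡ pair (λ j → f (suc j) - f j) r m
    pair-r f m eq = trans (pair-quot f 0ℚ A m eq)
      (solve 2 (λ x p → con 0ℚ :* x :+ p := p) refl (f m) (pair (λ j → f (suc j) - f j) r m))

    value-r : pair one r 0 ≡ 1ℚ + two * ρ
    value-r = begin
      pair one r 0
        ≡⟨ pair-cong (λ j → sym (trans (cong (_- nat j) (nat-suc j))
             (solve 1 (λ x → con 1ℚ :+ x :- x := con 1ℚ) refl (nat j)))) r 0 ⟩
      pair (λ j → nat (suc j) - nat j) r 0         ≡⟨ sym (pair-r nat 0 A[1]≡0) ⟩
      pair nat A 0                                 ≡⟨ pair-A nat 0 ⟩
      1ℚ * pair nat G′.Q 0 + (- c) * pair nat Q 0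
        ≡⟨ cong₂ (λ x x′ → 1ℚ * x + (- c) * x′) (trans G′.deriv (cong (_+ two * G′.d) (nat-suc e))) deriv ⟩
      1ℚ * (1ℚ + nat e + two * G′.d) + (- c) * (nat e + two * d)
        ≡⟨ solve 4 (λ e d d′ c′ → con 1ℚ :* (con 1ℚ :+ e :+ con two :* d′)
             :+ (:- (con 1ℚ :+ con two :* c′)) :* (e :+ con two :* d)
             := con 1ℚ :+ con two :* (d′ :- d :- c′ :* e :- con two :* (c′ :* d))) refl (nat e) d G′.d c′ ⟩
      1ℚ + two * ρ                                 ∎

    one-const : ∀ {n} (X : Vec ℚ n) m → pair one X m ≡ pair one X 0
    one-const X zero    = refl
    one-const X (suc m) = trans (pair-shift one X m) (one-const X m)

    open Interleave (pair w (dup r)) (λ _ → 0ℚ) (pair w A)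
      (λ m → begin
        pair w (dup r) (dbl m)                              ≡⟨ pair-dup w r m ⟩
        pair (λ j → w (dbl j) + w (suc (dbl j))) r m
          ≡⟨ pair-cong (λ j → trans (cong₂ _+_ (w-even j) (w-odd j))
               (solve 1 (λ x → x :+ con (- 1ℚ) :* x := con 0ℚ :* x :+ con 0ℚ :* x) refl (w j))) r m ⟩
        pair (λ j → 0ℚ * w j + 0ℚ * w j) r m                ≡⟨ pair-linear 0ℚ 0ℚ w w r m ⟩
        0ℚ * pair w r m + 0ℚ * pair w r m                   ≡⟨ solve 1 (λ x → con 0ℚ :* x :+ con 0ℚ :* x := con 0ℚ) refl (pair w r m) ⟩
        0ℚ                                                  ∎)
      (λ m → begin
        pair w (dup r) (suc (dbl m))                        ≡⟨ pair-shift w (dup r) (dbl m) ⟩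
        pair (λ j → w (suc j)) (dup r) (dbl m)              ≡⟨ pair-dup _ r m ⟩
        pair (λ j → w (suc (dbl j)) + w (dbl (suc j))) r m
          ≡⟨ pair-cong (λ j → trans (cong₂ _+_ (w-odd j) (w-even (suc j)))
               (solve 2 (λ x y → con (- 1ℚ) :* x :+ y := y :- x) refl (w j) (w (suc j)))) r m ⟩
        pair (λ j → w (suc j) - w j) r m                    ≡⟨ sym (pair-r w m (trans (one-const A m) A[1]≡0)) ⟩
        pair w A m                                          ∎)

  -- The degrees start at 1, because Q = 1 in degree 0 has an odd value at 1.
  good : ∀ n → Good (suc n)
  good = <-rec (λ n → Good (suc n)) step
    where
    step : ∀ n → (∀ {m} → m ℕ.< n → Good (suc m)) → Good (suc n)
    step n rec with parity n
    ... | even zero    = good-1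
    ... | even (suc e) = good-odd (suc e) (rec (s≤s (ℕ.m≤n⇒m≤1+n (dbl-≥ e)))) (rec (s≤s (s≤s (dbl-≥ e))))
    ... | odd  e       = good-even (suc e) (rec (s≤s (dbl-≥ e)))

  approx : ∀ n → Approx n 0
  approx zero    = 1ℚ ∷ [] , tt , λ ()
  approx (suc n) = Q , vanish , λ eq → invertible⇒≢0 _ (1/ two * y) (begin
      1/ two * y * (two * (1ℚ + two * z))
        ≡⟨ solve 3 (λ h y s → h :* y :* (con two :* s) := h :* con two :* (y :* s)) refl (1/ two) y (1ℚ + two * z) ⟩
      1/ two * two * (y * (1ℚ + two * z)) ≡⟨ cong (1/ two * two *_) y-inv ⟩
      1ℚ                                  ∎)
      (trans (sym value) (trans (pair-cong 1≡1^ Q 0) eq))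
    where
    open Good (good n)
    1≡1^ : ∀ j → 1ℚ ≡ 1ℚ ^ j
    1≡1^ zero    = refl
    1≡1^ (suc j) = trans (1≡1^ j) (sym (*-identityˡ (1ℚ ^ j)))
    inverse = unit-a Rz
    y = proj₁ inverse
    y-inv = proj₁ (proj₂ inverse)

  -- The start 0 = 2 · 0 is its own half, so the recursion stays at k = 0 and meets only
  -- approximants there.
  nondegenerate-0 : ∀ n → Nondeg n 0
  nondegenerate-0 = <-rec (λ n → Nondeg n 0) step
    where
    step : ∀ n → (∀ {m} → m ℕ.< n → Nondeg m 0) → Nondeg n 0
    step zero             _   = nondeg-0 0
    step (suc zero)       _   = nondeg-1 0
    step n@(suc (suc n′)) rec =
      nondeg-even n 0 (rec (ℕ.⌈n/2⌉<n n′)) (rec (ℕ.⌊n/2⌋<n (suc n′))) (approx ⌊ n /2⌋)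

-- From nonsingular Hankel matrices to lower bounds for |q| ‖q t^k g‖.

sumFin-pair : ∀ {n} f (c φ : Fin n → ℚ) m → (∀ j → φ j ≡ f (toℕ j ℕ.+ m)) →
              sumFin (λ j → c j * φ j) ≡ pair f (tabulate c) m
sumFin-pair {zero}  f c φ m eq = refl
sumFin-pair {suc n} f c φ m eq = cong₂ (λ x y → c zero * x + y) (eq zero)
  (sumFin-pair f (λ j → c (suc j)) (λ j → φ (suc j)) (suc m)
     λ j → trans (eq (suc j)) (cong f (sym (ℕ.+-suc (toℕ j) m))))

-- The exponent is one ahead of the index, as g begins with t⁻¹.
mulCoeff-pair : ∀ u q k i → mulCoeff q k (g u) (ℤ.+ suc i) ≡ pair (infProdCoeff u) (tabulate (cf q)) (i ℕ.+ k)
mulCoeff-pair u q k i = sumFin-pair (infProdCoeff u) (cf q) _ (i ℕ.+ k)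
  λ j → cong (infProdCoeff u) (rearrange i (toℕ j) k)
  where
  rearrange : ∀ i j k → i ℕ.+ j ℕ.+ k ≡ j ℕ.+ (i ℕ.+ k)
  rearrange = ℕ-Ring.solve-∀

2*≡+ : ∀ x → x + x ≡ 2ℚ * x
2*≡+ = solve 1 (λ x → x :+ x := con 2ℚ :* x) refl

1≤2^ : ∀ n → 1ℚ ≤ 2ℚ ^ n
1≤2^ zero    = ≤-refl
1≤2^ (suc n) = ≤-trans (from-yes (1ℚ ≤? 1ℚ + 1ℚ))
  (≤-trans (+-mono-≤ (1≤2^ n) (1≤2^ n)) (≤-reflexive (2*≡+ (2ℚ ^ n))))

½≤pow2 : ∀ d m → m ℕ.≤ suc d → ½ ≤ pow2 (ℤ.+ d ℤ.- ℤ.+ m)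
½≤pow2 d m m≤1+d with m ℕ.≤? d
... | yes m≤d = subst (λ z → ½ ≤ pow2 z) (sym (trans (ℤ.m-n≡m⊖n d m) (ℤ.⊖-≥ m≤d)))
                  (≤-trans (from-yes (½ ≤? 1ℚ)) (1≤2^ (d ∸ m)))
... | no  m≰d with ℕ.≤-antisym m≤1+d (ℕ.≰⇒> m≰d)
...   | refl = ≤-reflexive (cong pow2 (sym (trans (ℤ.m-n≡m⊖n d (suc d))
                 (trans (ℤ.⊖-≤ (ℕ.n≤1+n d)) (cong (λ i → ℤ.- (ℤ.+ i)) (ℕ.m+n∸n≡m 1 d))))))

-- If the coefficients of t⁻¹, ..., t^(-d-1) all vanished for q of degree d, its d + 1 coefficients
-- would be null, against the leading one. So ‖q t^k g‖ ≥ 2^(-d-1).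
nondeg⇒normProd≥ : ∀ u k δ → δ ≤ ½ →
  (∀ n (q : Vec ℚ n) → Vanish (pair (infProdCoeff u) q) k n → Null q) →
  ∀ q → NormProdGE (deg q) (mulCoeff q k (g u)) δ
nondeg⇒normProd≥ u k δ δ≤½ nd q =
  (λ b≡0 → contradiction (λ i _ → b≡0 (suc i) (s≤s z≤n)) early) ,
  (λ m (_ , _ , b≡0) → ≤-trans δ≤½ (½≤pow2 (deg q) m (m≤1+d m b≡0)))
  where
  b = mulCoeff q k (g u)

  early : ¬ (∀ i → i ℕ.< suc (deg q) → b (ℤ.+ suc i) ≡ 0ℚ)
  early b≡0 = lead q (tabulate⁻ {f = cf q} (nd _ (tabulate (cf q)) (Vanish-tabulate k _
    λ i i< → trans (sym (mulCoeff-pair u q k i)) (b≡0 i i<))) (fromℕ (deg q)))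

  m≤1+d : ∀ m → (∀ m′ → 1 ℕ.≤ m′ → m′ ℕ.< m → b (ℤ.+ m′) ≡ 0ℚ) → m ℕ.≤ suc (deg q)
  m≤1+d m b≡0 with m ℕ.≤? suc (deg q)
  ... | yes p = p
  ... | no  p = contradiction (λ i i< → b≡0 (suc i) (s≤s z≤n) (ℕ.<-≤-trans (s≤s i<) (ℕ.≰⇒> p))) early

-- Failure of the uniform bound for u = -1.

nat-≤ : ∀ {m n} → m ℕ.≤ n → nat m ≤ nat n
nat-≤ p = *≤* (ℤ.*-monoʳ-≤-nonNeg 1ℤ (ℤ.+≤+ p))

nat<2^ : ∀ n → nat n < 2ℚ ^ n
nat<2^ zero    = from-yes (0ℚ <? 1ℚ)
nat<2^ (suc n) = <-≤-trans
  (subst (_< 2ℚ ^ n + 2ℚ ^ n) (sym (nat-suc n)) (+-mono-≤-< (1≤2^ n) (nat<2^ n)))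
  (≤-reflexive (2*≡+ (2ℚ ^ n)))

2^*½^ : ∀ n → 2ℚ ^ n * ½ ^ n ≡ 1ℚ
2^*½^ zero    = refl
2^*½^ (suc n) = trans
  (solve 2 (λ x y → con 2ℚ :* x :* (con ½ :* y) := x :* y) refl (2ℚ ^ n) (½ ^ n)) (2^*½^ n)

-- For δ = (a + 1)/(d + 1) and n > d, assuming δ ≤ 2^(-n) would give 1 ≤ (d + 1) δ ≤ n δ < 2^n δ ≤
-- 1.
½^-archimedean : ∀ δ → 0ℚ < δ → ∃ λ N → ∀ n → N ℕ.≤ n → ½ ^ n < δ
½^-archimedean (mkℚ (ℤ.+ zero) d c) (*<* (ℤ.+<+ ()))
½^-archimedean (mkℚ -[1+ _ ]   d c) (*<* ())
½^-archimedean δ@(mkℚ +[1+ a ] d c) δ>0 = suc d , λ n d<n → ≰⇒> λ δ≤½^n →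
  <-irrefl refl (≤-<-trans (nat-≤ (s≤s (z≤n {a}))) (≤-<-trans (≤-reflexive (sym b*δ))
    (≤-<-trans (*-monoʳ-≤-nonNeg δ (nat-≤ d<n)) (<-≤-trans (*-monoˡ-<-pos δ (nat<2^ n))
      (≤-trans (*-monoˡ-≤-nonNeg (2ℚ ^ n) {{nonNegative (≤-trans (from-yes (0ℚ ≤? 1ℚ)) (1≤2^ n))}} δ≤½^n)
               (≤-reflexive (2^*½^ n)))))))
  where
  b = nat (suc d)
  b*δ : b * δ ≡ nat (suc a)
  b*δ = begin
    b * δ                    ≡⟨ cong (b *_) (sym (ι-÷ +[1+ a ] d c)) ⟩
    b * (nat (suc a) * 1/ b) ≡⟨ solve 3 (λ b x i → b :* (x :* i) := x :* (i :* b)) refl b (nat (suc a)) (1/ b) ⟩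
    nat (suc a) * (1/ b * b) ≡⟨ cong (nat (suc a) *_) (*-inverseˡ b) ⟩
    nat (suc a) * 1ℚ         ≡⟨ *-identityʳ (nat (suc a)) ⟩
    nat (suc a)              ∎

top : ∀ {n} → Fin (suc n) → ℚ
top {zero}  zero    = 1ℚ
top {suc n} zero    = 0ℚ
top {suc n} (suc j) = top j

top-fromℕ : ∀ n → top (fromℕ n) ≡ 1ℚ
top-fromℕ zero    = refl
top-fromℕ (suc n) = top-fromℕ n

sumFin-top : ∀ {n} (φ : Fin (suc n) → ℚ) → sumFin (λ j → top j * φ j) ≡ φ (fromℕ n)
sumFin-top {zero}  φ = solve 1 (λ x → con 1ℚ :* x :+ con 0ℚ := x) refl (φ zero)
sumFin-top {suc n} φ = trans (cong (0ℚ * φ zero +_) (sumFin-top (λ j → φ (suc j))))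
  (solve 2 (λ x y → con 0ℚ :* x :+ y := y) refl (φ zero) (φ (fromℕ (suc n))))

module _ where
  open Coefficients (- 1ℚ) using (w; w-even; w-odd)

  -- Powers of 2 as iterated `dbl`, so that `w-even` and `w-odd` apply without conversion.
  pow : ℕ → ℕ
  pow zero    = 1
  pow (suc i) = dbl (pow i)

  pow>i : ∀ i → i ℕ.< pow i
  pow>i zero    = s≤s z≤n
  pow>i (suc i) = ℕ.≤-trans (s≤s (pow>i i)) (1+n≤dbl (pow i) (ℕ.≤-trans (s≤s z≤n) (pow>i i)))
    where
    1+n≤dbl : ∀ n → 1 ℕ.≤ n → suc n ℕ.≤ dbl n
    1+n≤dbl (suc n) _ = s≤s (s≤s (dbl-≥ n))

  dbl-+₃ : ∀ n p → dbl n ℕ.+ dbl p ℕ.+ dbl (dbl p) ≡ dbl (n ℕ.+ p ℕ.+ dbl p)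
  dbl-+₃ n p = trans (cong (ℕ._+ dbl (dbl p)) (dbl-+ n p)) (dbl-+ (n ℕ.+ p) (dbl p))

  -- Antiperiodicity over a window of length 4p makes 1 + t^p approximate t^(2p) g too well.
  antiperiod : ∀ i n → n ℕ.< pow i ℕ.+ dbl (pow i) →
               w (n ℕ.+ pow i ℕ.+ dbl (pow i)) ≡ - w (n ℕ.+ dbl (pow i))
  antiperiod zero 0 _ = refl
  antiperiod zero 1 _ = refl
  antiperiod zero 2 _ = refl
  antiperiod zero (suc (suc (suc n))) (s≤s (s≤s (s≤s ())))
  antiperiod (suc i) n n< with parity n
  ... | even a = begin
    w (dbl a ℕ.+ dbl p ℕ.+ dbl (dbl p)) ≡⟨ cong w (dbl-+₃ a p) ⟩
    w (dbl (a ℕ.+ p ℕ.+ dbl p))         ≡⟨ w-even (a ℕ.+ p ℕ.+ dbl p) ⟩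
    w (a ℕ.+ p ℕ.+ dbl p)               ≡⟨ antiperiod i a a< ⟩
    - w (a ℕ.+ dbl p)                   ≡⟨ cong -_ (sym (w-even (a ℕ.+ dbl p))) ⟩
    - w (dbl (a ℕ.+ dbl p))             ≡⟨ cong (λ i → - w i) (sym (dbl-+ a (dbl p))) ⟩
    - w (dbl a ℕ.+ dbl (dbl p))         ∎
    where
    p = pow i
    a< : a ℕ.< p ℕ.+ dbl p
    a< = dbl-cancel (suc a) (p ℕ.+ dbl p) (s≤s (subst (suc (dbl a) ℕ.≤_) (dbl-+ p (dbl p)) n<))
  ... | odd a = begin
    w (suc (dbl a) ℕ.+ dbl p ℕ.+ dbl (dbl p)) ≡⟨ cong (λ i → w (suc i)) (dbl-+₃ a p) ⟩
    w (suc (dbl (a ℕ.+ p ℕ.+ dbl p)))         ≡⟨ w-odd (a ℕ.+ p ℕ.+ dbl p) ⟩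
    (- 1ℚ) * w (a ℕ.+ p ℕ.+ dbl p)            ≡⟨ cong ((- 1ℚ) *_) (antiperiod i a a<) ⟩
    (- 1ℚ) * (- w (a ℕ.+ dbl p))
      ≡⟨ solve 1 (λ x → con (- 1ℚ) :* (:- x) := :- (con (- 1ℚ) :* x)) refl (w (a ℕ.+ dbl p)) ⟩
    - ((- 1ℚ) * w (a ℕ.+ dbl p))              ≡⟨ cong -_ (sym (w-odd (a ℕ.+ dbl p))) ⟩
    - w (suc (dbl (a ℕ.+ dbl p)))             ≡⟨ cong (λ i → - w (suc i)) (sym (dbl-+ a (dbl p))) ⟩
    - w (suc (dbl a) ℕ.+ dbl (dbl p))         ∎
    where
    p = pow i
    a< : a ℕ.< p ℕ.+ dbl p
    a< = dbl-cancel (suc a) (p ℕ.+ dbl p) (ℕ.m≤n⇒m≤1+n (subst (suc (suc (dbl a)) ℕ.≤_) (dbl-+ p (dbl p)) n<))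

  -- Both 5 and 6 have digit sum 2. Hence w(5p) + w(6p) = 2 is the first nonzero coefficient of (1 +
  -- t^p) t^(2p) g in negative degree, that of t^(-3p-1).
  w-5p : ∀ i → w (pow i ℕ.+ dbl (pow i) ℕ.+ dbl (pow i)) ≡ 1ℚ
  w-5p zero    = refl
  w-5p (suc i) = trans (cong w (trans (cong (ℕ._+ dbl (dbl p)) (dbl-+ p (dbl p))) (dbl-+ (p ℕ.+ dbl p) (dbl p))))
                       (trans (w-even (p ℕ.+ dbl p ℕ.+ dbl p)) (w-5p i))
    where p = pow i

  w-6p : ∀ i → w (pow i ℕ.+ dbl (pow i) ℕ.+ pow i ℕ.+ dbl (pow i)) ≡ 1ℚ
  w-6p zero    = refl
  w-6p (suc i) = trans (cong w (trans (cong (λ j → j ℕ.+ dbl p ℕ.+ dbl (dbl p)) (dbl-+ p (dbl p))) (dbl-+₃ (p ℕ.+ dbl p) p)))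
                       (trans (w-even (p ℕ.+ dbl p ℕ.+ p ℕ.+ dbl p)) (w-6p i))
    where p = pow i

  -- 1 + t^(p′ + 1)
  binomial : ℕ → NZPoly
  binomial p′ = record
    { deg  = suc p′
    ; cf   = λ { zero → 1ℚ ; (suc j) → top j }
    ; lead = λ eq → contradiction (trans (sym (top-fromℕ p′)) eq) λ ()
    }

  mulCoeff-binomial : ∀ p′ k i → mulCoeff (binomial p′) k (g (- 1ℚ)) (ℤ.+ suc i) ≡
                      w (i ℕ.+ k) + w (i ℕ.+ suc p′ ℕ.+ k)
  mulCoeff-binomial p′ k i = begin
    1ℚ * w (i ℕ.+ 0 ℕ.+ k) + sumFin {suc p′} (λ j → top j * w (i ℕ.+ suc (toℕ j) ℕ.+ k))
      ≡⟨ cong₂ _+_ (trans (*-identityˡ (w (i ℕ.+ 0 ℕ.+ k))) (cong (λ l → w (l ℕ.+ k)) (ℕ.+-identityʳ i)))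
                   (sumFin-top {p′} (λ j → w (i ℕ.+ suc (toℕ j) ℕ.+ k))) ⟩
    w (i ℕ.+ k) + w (i ℕ.+ suc (toℕ (fromℕ p′)) ℕ.+ k)
      ≡⟨ cong (λ l → w (i ℕ.+ k) + w (i ℕ.+ suc l ℕ.+ k)) (toℕ-fromℕ p′) ⟩
    w (i ℕ.+ k) + w (i ℕ.+ suc p′ ℕ.+ k) ∎

  ¬ELC-[-1] : ¬ ELC (g (- 1ℚ))
  ¬ELC-[-1] (δ , δ>0 , elc) = contradict (pow N) refl (ℕ.≤-trans (s≤s z≤n) (pow>i N))
    where
    N  = proj₁ (½^-archimedean δ δ>0)
    ½< = proj₂ (½^-archimedean δ δ>0)

    -- The power 2^N is generalised to p, to be matched as a successor for `binomial`.
    contradict : ∀ p → p ≡ pow N → 1 ℕ.≤ p → ⊥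
    contradict p@(suc p′) p≡ _ = <-irrefl refl (≤-<-trans (subst (λ z → δ ≤ pow2 z) exponent
        (proj₂ (elc (binomial p′) (dbl p)) (suc (p ℕ.+ dbl p)) (s≤s z≤n , nonzero , zeros))) (½< (suc (dbl p)) N≤))
      where
      b = mulCoeff (binomial p′) (dbl p) (g (- 1ℚ))

      N≤ : N ℕ.≤ suc (dbl p)
      N≤ = ℕ.≤-trans (ℕ.<⇒≤ (subst (N ℕ.<_) (sym p≡) (pow>i N))) (ℕ.m≤n⇒m≤1+n (dbl-≥ p))

      exponent : ℤ.+ p ℤ.- ℤ.+ suc (p ℕ.+ dbl p) ≡ -[1+ dbl p ]
      exponent = trans (ℤ.m-n≡m⊖n p (suc (p ℕ.+ dbl p)))
        (trans (ℤ.⊖-≤ (ℕ.m≤n⇒m≤1+n (ℕ.m≤m+n p (dbl p))))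
               (cong (λ l → ℤ.- (ℤ.+ l)) (trans (cong (_∸ p) (sym (ℕ.+-suc p (dbl p)))) (ℕ.m+n∸m≡n p (suc (dbl p))))))

      nonzero : b (ℤ.+ suc (p ℕ.+ dbl p)) ≢ 0ℚ
      nonzero eq = contradiction (trans (sym (trans (mulCoeff-binomial p′ (dbl p) (p ℕ.+ dbl p))
        (cong₂ _+_ (subst (λ p → w (p ℕ.+ dbl p ℕ.+ dbl p) ≡ 1ℚ) (sym p≡) (w-5p N))
                   (subst (λ p → w (p ℕ.+ dbl p ℕ.+ p ℕ.+ dbl p) ≡ 1ℚ) (sym p≡) (w-6p N))))) eq) λ ()

      zeros : ∀ m → 1 ℕ.≤ m → m ℕ.< suc (p ℕ.+ dbl p) → b (ℤ.+ m) ≡ 0ℚ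
      zeros (suc i) _ (s≤s i<) = trans (mulCoeff-binomial p′ (dbl p) i)
        (trans (cong (w (i ℕ.+ dbl p) +_)
                  (subst (λ p → i ℕ.< p ℕ.+ dbl p → w (i ℕ.+ p ℕ.+ dbl p) ≡ - w (i ℕ.+ dbl p)) (sym p≡)
                     (antiperiod N i) i<))
               (solve 1 (λ x → x :+ (:- x) := con 0ℚ) refl (w (i ℕ.+ dbl p))))

theorem2 : ((u : ℚ) → u ≢ - 1ℚ → u ≢ 0ℚ → u ≢ 1ℚ → ELC[ ½ ] (g u))
    × (Bad[ ½ ] (g (- 1ℚ)) × ¬ ELC (g (- 1ℚ)))
theorem2 =
  (λ u u≢-1 u≢0 u≢1 q k → nondeg⇒normProd≥ u k ½ ≤-refl
     (λ n → nondegenerate u u≢-1 u≢0 u≢1 n k) q) ,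
  -- The bound ½ holds for every q, so the threshold is 0 and ε only weakens it.
  (λ ε ε>0 → 0 , λ q _ → nondeg⇒normProd≥ (- 1ℚ) 0 (½ - ε)
     (≤-trans (+-monoʳ-≤ ½ (neg-antimono-≤ (<⇒≤ ε>0))) (≤-reflexive (+-identityʳ ½)))
     ThueMorse.nondegenerate-0 q) ,
  ¬ELC-[-1]
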